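{- Let $m\geq 3$ be an integer, let $\beta\in(0,1)$ be a real number satisfying $\beta^2-m\beta=-1$, and let $(G_n)_{n\geq 0}$ be the integer sequence defined by $G_0=0$, $G_1=1$, $G_{n+2}=mG_{n+1}-G_n$ for $n\geq 0$. For an integer $i\geq 1$ put $$V_i=\bigl\{kG_{i+1}-(\lfloor k\beta\rfloor+1)G_i \,\bigm|\, k\in\mathbb{Z}\bigr\}.$$ Then for every $j\in\mathbb{Z}$ we have $$\bigl\lfloor \beta(j+G_i)\bigr\rfloor = \lfloor \beta j\rfloor + G_{i-1}+\varepsilon_i(j),\qquad\text{where}\quad \varepsilon_i(j)=\begin{cases}0 & \text{if } j\notin V_i,\\ 1 & \text{if } j\in V_i.\end{cases}$$ Moreover, the density of the set $V_i$ of mismatches exists and is equal to $\beta^i$.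
   Context: $\lfloor x\rfloor$ denotes the greatest integer not exceeding the real number $x$. The density (frequency) of a set $S\subset\mathbb{Z}$ is $\lim_{n\to\infty}\frac{\#\{j\in S\,\mid\, -n\leq j\leq n\}}{2n+1}$. -}

module Defs where

open import Algebra.Bundles using (CommutativeMonoid)
import Algebra.Properties.CommutativeSemigroup as CommutativeSemigroupProperties
import Algebra.Properties.Group as GroupProperties
open import Data.Bool.Base using (if_then_else_)
open import Data.Integer.Base as ℤ using (ℤ; +_; 0ℤ; 1ℤ)
open import Data.List.Base using (List; map; upTo; filter; length)
open import Data.Nat.Base as ℕ using (ℕ; zero; suc; _⊔_)
import Data.Nat.Properties as ℕ
open import Data.Product.Base using (_×_; _,_; ∃₂; Σ-syntax)
open import Data.Rational.Base as ℚ using (ℚ; 0ℚ; 1ℚ; ½; ∣_∣)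
import Data.Rational.Properties as ℚ
open import Data.Sum.Base using (inj₁; inj₂)
open import Level using (0ℓ)
open import Relation.Binary.PropositionalEquality
  using (_≡_; refl; sym; trans; cong; cong₂; subst; subst₂; module ≡-Reasoning)
open import Relation.Nullary using (¬_; Dec; does)
open import Relation.Unary using (Pred; Decidable)

-- A real number is a Cauchy sequence of rationals; equality of reals is _≃_,
-- so operations can be taken termwise.

Cauchy : (ℕ → ℚ) → Set
Cauchy x = ∀ (ε : ℚ) → 0ℚ ℚ.< ε →
  Σ[ N ∈ ℕ ] (∀ m n → N ℕ.≤ m → N ℕ.≤ n → ∣ x m ℚ.- x n ∣ ℚ.< ε)

record ℝ : Set where
  constructor mkℝ
  field
    seq    : ℕ → ℚ
    cauchy : Cauchy seq

open ℝ public

infix  4 _≃_ _<_ _≤_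
infixl 6 _+_ _-_
infixl 7 _*_
infix  8 -_
infixr 8 _^_

_≃_ : ℝ → ℝ → Set
x ≃ y = ∀ (ε : ℚ) → 0ℚ ℚ.< ε →
  Σ[ N ∈ ℕ ] (∀ n → N ℕ.≤ n → ∣ seq x n ℚ.- seq y n ∣ ℚ.< ε)

_<_ : ℝ → ℝ → Set
x < y = Σ[ ε ∈ ℚ ] 0ℚ ℚ.< ε ×
  Σ[ N ∈ ℕ ] (∀ n → N ℕ.≤ n → seq x n ℚ.+ ε ℚ.< seq y n)

_≤_ : ℝ → ℝ → Set
x ≤ y = ¬ (y < x)

fromℚ : ℚ → ℝ
fromℚ q = mkℝ (λ _ → q) λ ε 0<ε → 0 , λ _ _ _ _ →
  subst (ℚ._< ε) (sym (cong ∣_∣ (ℚ.+-inverseʳ q))) 0<ε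

fromℤ : ℤ → ℝ
fromℤ z = fromℚ (z ℚ./ 1)

0ℝ 1ℝ : ℝ
0ℝ = fromℤ 0ℤ
1ℝ = fromℤ 1ℤ

private
  open GroupProperties ℚ.+-0-group
    using (⁻¹-anti-homo-//; //-rightDividesˡ; //-rightDividesʳ)
  open CommutativeSemigroupProperties
    (CommutativeMonoid.commutativeSemigroup ℚ.+-0-commutativeMonoid)
    using (interchange)

  +-minus-interchange : ∀ a b c d →
    (a ℚ.- b) ℚ.+ (c ℚ.- d) ≡ (a ℚ.+ c) ℚ.- (b ℚ.+ d)
  +-minus-interchange a b c d = trans (interchange a (ℚ.- b) c (ℚ.- d))
    (cong (a ℚ.+ c ℚ.+_) (sym (ℚ.neg-distrib-+ b d)))

  *-minus-split : ∀ a b c d →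
    a ℚ.* (c ℚ.- d) ℚ.+ (a ℚ.- b) ℚ.* d ≡ a ℚ.* c ℚ.- b ℚ.* d
  *-minus-split a b c d = begin
    a ℚ.* (c ℚ.- d) ℚ.+ (a ℚ.- b) ℚ.* d
      ≡⟨ cong₂ ℚ._+_ (ℚ.*-distribˡ-+ a c (ℚ.- d)) (ℚ.*-distribʳ-+ d a (ℚ.- b)) ⟩
    (a ℚ.* c ℚ.+ a ℚ.* ℚ.- d) ℚ.+ (a ℚ.* d ℚ.+ ℚ.- b ℚ.* d)
      ≡⟨ cong₂ (λ u v → (a ℚ.* c ℚ.+ u) ℚ.+ (a ℚ.* d ℚ.+ v))
           (sym (ℚ.neg-distribʳ-* a d)) (sym (ℚ.neg-distribˡ-* b d)) ⟩
    (a ℚ.* c ℚ.- a ℚ.* d) ℚ.+ (a ℚ.* d ℚ.- b ℚ.* d)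
      ≡⟨ sym (ℚ.+-assoc (a ℚ.* c ℚ.- a ℚ.* d) (a ℚ.* d) (ℚ.- (b ℚ.* d))) ⟩
    ((a ℚ.* c ℚ.- a ℚ.* d) ℚ.+ a ℚ.* d) ℚ.- b ℚ.* d
      ≡⟨ cong (ℚ._- b ℚ.* d) (//-rightDividesˡ (a ℚ.* d) (a ℚ.* c)) ⟩
    a ℚ.* c ℚ.- b ℚ.* d ∎
    where open ≡-Reasoning

  ½-pos : ∀ {ε} → 0ℚ ℚ.< ε → 0ℚ ℚ.< ½ ℚ.* ε
  ½-pos {ε} 0<ε = subst (ℚ._< ½ ℚ.* ε) (ℚ.*-zeroʳ ½) (ℚ.*-monoʳ-<-pos ½ 0<ε)

  halves : ∀ ε → ½ ℚ.* ε ℚ.+ ½ ℚ.* ε ≡ ε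
  halves ε = trans (sym (ℚ.*-distribʳ-+ ε ½ ½)) (ℚ.*-identityˡ ε)

  -‿swap : ∀ p q → ∣ p ℚ.- q ∣ ≡ ∣ q ℚ.- p ∣
  -‿swap p q = trans (sym (ℚ.∣-p∣≡∣p∣ (p ℚ.- q)))
    (cong ∣_∣ (⁻¹-anti-homo-// p q))

  ∣p∣≤∣p-q∣+∣q∣ : ∀ p q → ∣ p ∣ ℚ.≤ ∣ p ℚ.- q ∣ ℚ.+ ∣ q ∣
  ∣p∣≤∣p-q∣+∣q∣ p q = subst (λ r → ∣ r ∣ ℚ.≤ ∣ p ℚ.- q ∣ ℚ.+ ∣ q ∣)
    (//-rightDividesˡ q p)
    (ℚ.∣p+q∣≤∣p∣+∣q∣ (p ℚ.- q) q)

  ∣p∣-∣q∣≤∣p-q∣ : ∀ p q → ∣ p ∣ ℚ.- ∣ q ∣ ℚ.≤ ∣ p ℚ.- q ∣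
  ∣p∣-∣q∣≤∣p-q∣ p q = subst (∣ p ∣ ℚ.- ∣ q ∣ ℚ.≤_)
    (//-rightDividesʳ ∣ q ∣ ∣ p ℚ.- q ∣)
    (ℚ.+-monoˡ-≤ (ℚ.- ∣ q ∣) (∣p∣≤∣p-q∣+∣q∣ p q))

  ∣∣p∣-∣q∣∣≤∣p-q∣ : ∀ p q → ∣ ∣ p ∣ ℚ.- ∣ q ∣ ∣ ℚ.≤ ∣ p ℚ.- q ∣
  ∣∣p∣-∣q∣∣≤∣p-q∣ p q with ℚ.∣p∣≡p∨∣p∣≡-p (∣ p ∣ ℚ.- ∣ q ∣)
  ... | inj₁ eq = subst (ℚ._≤ ∣ p ℚ.- q ∣) (sym eq) (∣p∣-∣q∣≤∣p-q∣ p q)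
  ... | inj₂ eq = subst₂ ℚ._≤_
    (trans (sym (⁻¹-anti-homo-// ∣ p ∣ ∣ q ∣)) (sym eq))
    (-‿swap q p) (∣p∣-∣q∣≤∣p-q∣ q p)

  eventually-bounded : ∀ x → Cauchy x → Σ[ B ∈ ℚ ] 0ℚ ℚ.< B ×
    Σ[ N ∈ ℕ ] (∀ n → N ℕ.≤ n → ∣ x n ∣ ℚ.≤ B)
  eventually-bounded x cx with cx 1ℚ (ℚ.positive⁻¹ 1ℚ)
  ... | N , close =
    1ℚ ℚ.+ ∣ x N ∣
    , ℚ.+-mono-<-≤ (ℚ.positive⁻¹ 1ℚ) (ℚ.0≤∣p∣ (x N))
    , N
    , λ n N≤n → ℚ.≤-trans (∣p∣≤∣p-q∣+∣q∣ (x n) (x N))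
        (ℚ.+-monoˡ-≤ ∣ x N ∣ (ℚ.<⇒≤ (close n N N≤n ℕ.≤-refl)))

  +-cauchy : ∀ x y → Cauchy x → Cauchy y → Cauchy (λ n → x n ℚ.+ y n)
  +-cauchy x y cx cy ε 0<ε
    with cx (½ ℚ.* ε) (½-pos 0<ε) | cy (½ ℚ.* ε) (½-pos 0<ε)
  ... | M , hx | N , hy = M ⊔ N , λ m n p q →
    subst₂ ℚ._<_
      refl (halves ε)
      (ℚ.≤-<-trans
        (subst (λ r → ∣ r ∣ ℚ.≤ ∣ x m ℚ.- x n ∣ ℚ.+ ∣ y m ℚ.- y n ∣)
          (+-minus-interchange (x m) (x n) (y m) (y n))
          (ℚ.∣p+q∣≤∣p∣+∣q∣ (x m ℚ.- x n) (y m ℚ.- y n)))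
        (ℚ.+-mono-<
          (hx m n (ℕ.m⊔n≤o⇒m≤o M N p) (ℕ.m⊔n≤o⇒m≤o M N q))
          (hy m n (ℕ.m⊔n≤o⇒n≤o M N p) (ℕ.m⊔n≤o⇒n≤o M N q))))

  neg-cauchy : ∀ x → Cauchy x → Cauchy (λ n → ℚ.- x n)
  neg-cauchy x cx ε 0<ε with cx ε 0<ε
  ... | N , h = N , λ m n p q → subst (ℚ._< ε)
    (cong ∣_∣ (ℚ.neg-distrib-+ (x m) (ℚ.- x n)))
    (subst (ℚ._< ε) (sym (ℚ.∣-p∣≡∣p∣ (x m ℚ.- x n))) (h m n p q))

  abs-cauchy : ∀ x → Cauchy x → Cauchy (λ n → ∣ x n ∣)
  abs-cauchy x cx ε 0<ε with cx ε 0<ε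
  ... | N , h = N , λ m n p q →
    ℚ.≤-<-trans (∣∣p∣-∣q∣∣≤∣p-q∣ (x m) (x n)) (h m n p q)

  *-cauchy : ∀ x y → Cauchy x → Cauchy y → Cauchy (λ n → x n ℚ.* y n)
  *-cauchy x y cx cy ε 0<ε
    with eventually-bounded x cx | eventually-bounded y cy
  ... | A , 0<A , K , bx | B , 0<B , L , by = result
    where
    C : ℚ
    C = A ℚ.+ B

    instance
      A-pos : ℚ.Positive A
      A-pos = ℚ.positive 0<A
      B-pos : ℚ.Positive B
      B-pos = ℚ.positive 0<B
      C-pos : ℚ.Positive C
      C-pos = ℚ.positive (ℚ.+-mono-< 0<A 0<B)
      C-nonZero : ℚ.NonZero C
      C-nonZero = ℚ.pos⇒nonZero C
      1/C-pos : ℚ.Positive (ℚ.1/ C)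
      1/C-pos = ℚ.1/pos⇒pos C

    δ : ℚ
    δ = ε ℚ.* ℚ.1/ C

    0<δ : 0ℚ ℚ.< δ
    0<δ = subst (ℚ._< δ) (ℚ.*-zeroˡ (ℚ.1/ C)) (ℚ.*-monoˡ-<-pos (ℚ.1/ C) 0<ε)

    Aδ+δB≡ε : A ℚ.* δ ℚ.+ δ ℚ.* B ≡ ε
    Aδ+δB≡ε = begin
      A ℚ.* δ ℚ.+ δ ℚ.* B   ≡⟨ cong (ℚ._+ δ ℚ.* B) (ℚ.*-comm A δ) ⟩
      δ ℚ.* A ℚ.+ δ ℚ.* B   ≡⟨ sym (ℚ.*-distribˡ-+ δ A B) ⟩
      ε ℚ.* ℚ.1/ C ℚ.* C    ≡⟨ ℚ.*-assoc ε (ℚ.1/ C) C ⟩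
      ε ℚ.* (ℚ.1/ C ℚ.* C)  ≡⟨ cong (ε ℚ.*_) (ℚ.*-inverseˡ C) ⟩
      ε ℚ.* 1ℚ              ≡⟨ ℚ.*-identityʳ ε ⟩
      ε                     ∎
      where open ≡-Reasoning

    result : Σ[ N ∈ ℕ ] (∀ m n → N ℕ.≤ m → N ℕ.≤ n →
               ∣ x m ℚ.* y m ℚ.- x n ℚ.* y n ∣ ℚ.< ε)
    result with cx δ 0<δ | cy δ 0<δ
    ... | M , hx | N , hy = (K ⊔ L) ⊔ (M ⊔ N) , λ m n p q →
      let pKL = ℕ.m⊔n≤o⇒m≤o (K ⊔ L) (M ⊔ N) p
          qKL = ℕ.m⊔n≤o⇒m≤o (K ⊔ L) (M ⊔ N) q
          pMN = ℕ.m⊔n≤o⇒n≤o (K ⊔ L) (M ⊔ N) p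
          qMN = ℕ.m⊔n≤o⇒n≤o (K ⊔ L) (M ⊔ N) q
          dx = x m ℚ.- x n
          dy = y m ℚ.- y n
          dx<δ = hx m n (ℕ.m⊔n≤o⇒m≤o M N pMN) (ℕ.m⊔n≤o⇒m≤o M N qMN)
          dy<δ = hy m n (ℕ.m⊔n≤o⇒n≤o M N pMN) (ℕ.m⊔n≤o⇒n≤o M N qMN)
          first : ∣ x m ℚ.* dy ∣ ℚ.< A ℚ.* δ
          first = subst (ℚ._< A ℚ.* δ) (sym (ℚ.∣p*q∣≡∣p∣*∣q∣ (x m) dy))
            (ℚ.≤-<-trans
              (ℚ.*-monoʳ-≤-nonNeg ∣ dy ∣ {{ℚ.∣-∣-nonNeg dy}}
                (bx m (ℕ.m⊔n≤o⇒m≤o K L pKL)))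
              (ℚ.*-monoʳ-<-pos A dy<δ))
          second : ∣ dx ℚ.* y n ∣ ℚ.< δ ℚ.* B
          second = subst (ℚ._< δ ℚ.* B) (sym (ℚ.∣p*q∣≡∣p∣*∣q∣ dx (y n)))
            (ℚ.≤-<-trans
              (ℚ.*-monoˡ-≤-nonNeg ∣ dx ∣ {{ℚ.∣-∣-nonNeg dx}}
                (by n (ℕ.m⊔n≤o⇒n≤o K L qKL)))
              (ℚ.*-monoˡ-<-pos B dx<δ))
      in subst₂ ℚ._<_
           (cong ∣_∣ (*-minus-split (x m) (x n) (y m) (y n)))
           Aδ+δB≡ε
           (ℚ.≤-<-trans (ℚ.∣p+q∣≤∣p∣+∣q∣ (x m ℚ.* dy) (dx ℚ.* y n))
             (ℚ.+-mono-< first second))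

_+_ : ℝ → ℝ → ℝ
x + y = mkℝ (λ n → seq x n ℚ.+ seq y n) (+-cauchy (seq x) (seq y) (cauchy x) (cauchy y))

-_ : ℝ → ℝ
- x = mkℝ (λ n → ℚ.- seq x n) (neg-cauchy (seq x) (cauchy x))

_-_ : ℝ → ℝ → ℝ
x - y = x + - y

_*_ : ℝ → ℝ → ℝ
x * y = mkℝ (λ n → seq x n ℚ.* seq y n) (*-cauchy (seq x) (seq y) (cauchy x) (cauchy y))

abs : ℝ → ℝ
abs x = mkℝ (λ n → ∣ seq x n ∣) (abs-cauchy (seq x) (cauchy x))

_^_ : ℝ → ℕ → ℝ
x ^ zero  = 1ℝ
x ^ suc n = x * x ^ n

-- A relation, since no floor function on ℝ is definable constructively.
record IsFloor (x : ℝ) (n : ℤ) : Set where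
  field
    below    : fromℤ n ≤ x
    greatest : ∀ k → fromℤ k ≤ x → k ℤ.≤ n

_⟶_ : (ℕ → ℝ) → ℝ → Set
u ⟶ L = ∀ (ε : ℝ) → 0ℝ < ε →
  Σ[ N ∈ ℕ ] (∀ n → N ℕ.≤ n → abs (u n - L) < ε)

-- The integers -n, …, n.
window : ℕ → List ℤ
window n = map (λ k → + k ℤ.- + n) (upTo (suc (2 ℕ.* n)))

module _ {S : Pred ℤ 0ℓ} (S? : Decidable S) where

  count : ℕ → ℕ
  count n = length (filter S? (window n))

  HasDensity : ℝ → Set
  HasDensity d = (λ n → fromℚ (+ count n ℚ./ suc (2 ℕ.* n))) ⟶ d

G : ℤ → ℕ → ℤ
G m zero          = 0ℤ
G m (suc zero)    = 1ℤ
G m (suc (suc n)) = m ℤ.* G m (suc n) ℤ.- G m n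

V : ℤ → ℝ → ℕ → Pred ℤ 0ℓ
V m β i j = ∃₂ λ k f → IsFloor (fromℤ k * β) f ×
  j ≡ k ℤ.* G m (suc i) ℤ.- (f ℤ.+ 1ℤ) ℤ.* G m i

indicator : {A : Set} → Dec A → ℤ
indicator d = if does d then 1ℤ else 0ℤ

{-# OPTIONS --safe #-}
module Submission where

-- Put β^i = g β - h with g = G i and h = G (i-1). Then β (j + g) = β j + h + β^i,
-- so ⌊β (j + g)⌋ exceeds ⌊β j⌋ + h, by one, exactly when 0 < p - β j ≤ β^i for some
-- integer p; dividing p - β j by the unit β^i of ℤ[β] turns this into the definition of V.
-- Comparisons in ℤ[β] are decided by a Euclidean descent, which makes floors computable.
-- With Σ j = ⌊β j⌋ + … + ⌊β (j + g - 1)⌋ the indicator of V is Σ (j + 1) - Σ j - h, so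
-- counts over windows telescope and differ from β^i times the length by at most g.

open import Defs
open import Data.Integer.Base as ℤ using (ℤ; +_; -[1+_]; 0ℤ; 1ℤ; -1ℤ)
import Data.Integer.Properties as ℤ
open import Data.Integer.Tactic.RingSolver using (solve-∀)
open import Data.List.Base using (_∷_; applyUpTo; filter; length)
open import Data.List.Properties using (map-upTo)
open import Data.Nat.Base as ℕ using (ℕ; zero; suc; _⊔_)
open import Data.Nat.Induction using (<-wellFounded)
import Data.Nat.Properties as ℕ
open import Data.Product.Base using (_×_; _,_; proj₁; proj₂; ∃₂; Σ-syntax)
open import Data.Rational.Base as ℚ using (ℚ; 0ℚ; 1ℚ; ½; ∣_∣)
import Data.Rational.Properties as ℚ
open import Data.Rational.Solver using (module +-*-Solver)
open import Data.Rational.Unnormalised.Base as ℚᵘ using (mkℚᵘ)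
import Data.Rational.Unnormalised.Properties as ℚᵘ
open import Data.Sum.Base using (_⊎_; inj₁; inj₂)
open import Function.Base using (_∘_)
open import Induction.WellFounded using (Acc; acc)
open import Level using (0ℓ)
open import Relation.Binary.PropositionalEquality
  using (_≡_; refl; sym; trans; cong; cong₂; subst; subst₂)
open import Relation.Nullary using (¬_; Dec; yes; no; contradiction)
open import Relation.Unary using (Pred; Decidable)

open +-*-Solver using (solve; _:=_; _:+_; _:*_; _:-_; :-_; con)

-- The order on ℝ is undecidable and the terms of `β` satisfy its equation only in the limit, so
-- floors cannot be read off from rational terms. The proof computes instead with pairs `(u , v)`
-- standing for `u + v β`, where identities are exact integer identities. The terms of `β` enter
-- only to show that positivity respects sums and products, and to pass between pairs and ℝ. Unless
-- both coefficients vanish, the descent ends in a strict inequality. This contains the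
-- irrationality of `β` and lets zero be recognised by its coefficients. Division by β^i turns 0 < p
-- - β j ≤ β^i into 0 < f + 1 - k β ≤ 1, which says that f is the floor of k β; on pairs,
-- multiplication by β^i is a unimodular substitution, so no pair is lost. The error bound g is the
-- number of terms of Σ: shifting the argument by t changes each term by t β up to an error below 1,
-- and t β^i = g t β - h t.

-- Integers inside the rationals, and rational estimates.

ι : ℤ → ℚ
ι a = a ℚ./ 1

toℚᵘ-ι : ∀ a → ℚ.toℚᵘ (ι a) ℚᵘ.≃ mkℚᵘ a 0
toℚᵘ-ι a = ℚ.toℚᵘ-fromℚᵘ (mkℚᵘ a 0)

ι-+ : ∀ a b → ι (a ℤ.+ b) ≡ ι a ℚ.+ ι b
ι-+ a b = ℚ.toℚᵘ-injective (begin
  ℚ.toℚᵘ (ι (a ℤ.+ b))               ≈⟨ toℚᵘ-ι (a ℤ.+ b) ⟩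
  mkℚᵘ (a ℤ.+ b) 0                   ≡⟨ cong₂ (λ x y → mkℚᵘ (x ℤ.+ y) 0) (ℤ.*-identityʳ a) (ℤ.*-identityʳ b) ⟨
  mkℚᵘ a 0 ℚᵘ.+ mkℚᵘ b 0             ≈⟨ ℚᵘ.+-cong (toℚᵘ-ι a) (toℚᵘ-ι b) ⟨
  ℚ.toℚᵘ (ι a) ℚᵘ.+ ℚ.toℚᵘ (ι b)     ≈⟨ ℚ.toℚᵘ-homo-+ (ι a) (ι b) ⟨
  ℚ.toℚᵘ (ι a ℚ.+ ι b)               ∎)
  where open import Relation.Binary.Reasoning.Setoid ℚᵘ.≃-setoid

ι-* : ∀ a b → ι (a ℤ.* b) ≡ ι a ℚ.* ι b
ι-* a b = ℚ.toℚᵘ-injective (begin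
  ℚ.toℚᵘ (ι (a ℤ.* b))               ≈⟨ toℚᵘ-ι (a ℤ.* b) ⟩
  mkℚᵘ a 0 ℚᵘ.* mkℚᵘ b 0             ≈⟨ ℚᵘ.*-cong (toℚᵘ-ι a) (toℚᵘ-ι b) ⟨
  ℚ.toℚᵘ (ι a) ℚᵘ.* ℚ.toℚᵘ (ι b)     ≈⟨ ℚ.toℚᵘ-homo-* (ι a) (ι b) ⟨
  ℚ.toℚᵘ (ι a ℚ.* ι b)               ∎)
  where open import Relation.Binary.Reasoning.Setoid ℚᵘ.≃-setoid

ι-neg : ∀ a → ι (ℤ.- a) ≡ ℚ.- ι a
ι-neg a = ℚ.toℚᵘ-injective (begin
  ℚ.toℚᵘ (ι (ℤ.- a))       ≈⟨ toℚᵘ-ι (ℤ.- a) ⟩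
  ℚᵘ.- mkℚᵘ a 0            ≈⟨ ℚᵘ.-‿cong (toℚᵘ-ι a) ⟨
  ℚᵘ.- ℚ.toℚᵘ (ι a)        ≈⟨ ℚ.toℚᵘ-homo‿- (ι a) ⟨
  ℚ.toℚᵘ (ℚ.- ι a)         ∎)
  where open import Relation.Binary.Reasoning.Setoid ℚᵘ.≃-setoid

ι-mono-≤ : ∀ a b → a ℤ.≤ b → ι a ℚ.≤ ι b
ι-mono-≤ a b a≤b = ℚ.toℚᵘ-cancel-≤ (begin
  ℚ.toℚᵘ (ι a)   ≃⟨ toℚᵘ-ι a ⟩
  mkℚᵘ a 0       ≤⟨ ℚᵘ.*≤* (ℤ.*-monoʳ-≤-nonNeg 1ℤ a≤b) ⟩
  mkℚᵘ b 0       ≃⟨ toℚᵘ-ι b ⟨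
  ℚ.toℚᵘ (ι b)   ∎)
  where open ℚᵘ.≤-Reasoning

/-*-ι : ∀ a d → (a ℚ./ suc d) ℚ.* ι (+ suc d) ≡ ι a
/-*-ι a d = ℚ.toℚᵘ-injective (begin
  ℚ.toℚᵘ (a ℚ./ suc d ℚ.* ι (+ suc d))           ≈⟨ ℚ.toℚᵘ-homo-* (a ℚ./ suc d) (ι (+ suc d)) ⟩
  ℚ.toℚᵘ (a ℚ./ suc d) ℚᵘ.* ℚ.toℚᵘ (ι (+ suc d)) ≈⟨ ℚᵘ.*-cong (ℚ.toℚᵘ-fromℚᵘ (mkℚᵘ a d)) (toℚᵘ-ι (+ suc d)) ⟩
  mkℚᵘ a d ℚᵘ.* mkℚᵘ (+ suc d) 0                  ≈⟨ ℚᵘ.*≡* (ℤ.*-assoc a (+ suc d) 1ℤ) ⟩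
  mkℚᵘ a 0                                        ≈⟨ toℚᵘ-ι a ⟨
  ℚ.toℚᵘ (ι a)                                    ∎)
  where open import Relation.Binary.Reasoning.Setoid ℚᵘ.≃-setoid

½-pos : ∀ {ε} → 0ℚ ℚ.< ε → 0ℚ ℚ.< ½ ℚ.* ε
½-pos {ε} 0<ε = subst (ℚ._< ½ ℚ.* ε) (ℚ.*-zeroʳ ½) (ℚ.*-monoʳ-<-pos ½ 0<ε)

halves : ∀ ε → ½ ℚ.* ε ℚ.+ ½ ℚ.* ε ≡ ε
halves ε = trans (sym (ℚ.*-distribʳ-+ ε ½ ½)) (ℚ.*-identityˡ ε)

*-pos : ∀ {p q} → 0ℚ ℚ.< p → 0ℚ ℚ.< q → 0ℚ ℚ.< p ℚ.* q
*-pos {p} {q} 0<p 0<q = subst (ℚ._< p ℚ.* q) (ℚ.*-zeroˡ q)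
  (ℚ.*-monoˡ-<-pos q {{ℚ.positive 0<q}} 0<p)

*-mono-<-pos : ∀ {p q r s} → 0ℚ ℚ.< p → 0ℚ ℚ.< r → p ℚ.< q → r ℚ.< s → p ℚ.* r ℚ.< q ℚ.* s
*-mono-<-pos {p} {q} {r} {s} 0<p 0<r p<q r<s = ℚ.<-trans
  (ℚ.*-monoˡ-<-pos r {{ℚ.positive 0<r}} p<q)
  (ℚ.*-monoʳ-<-pos q {{ℚ.positive (ℚ.<-trans 0<p p<q)}} r<s)

p≤∣p∣ : ∀ p → p ℚ.≤ ∣ p ∣
p≤∣p∣ p with ℚ.≤-total 0ℚ p
... | inj₁ 0≤p = ℚ.≤-reflexive (sym (ℚ.0≤p⇒∣p∣≡p 0≤p))
... | inj₂ p≤0 = ℚ.≤-trans p≤0 (ℚ.0≤∣p∣ p)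

∣p∣≤ : ∀ {p q} → p ℚ.≤ q → ℚ.- p ℚ.≤ q → ∣ p ∣ ℚ.≤ q
∣p∣≤ {p} {q} p≤q -p≤q with ℚ.∣p∣≡p∨∣p∣≡-p p
... | inj₁ eq = subst (ℚ._≤ q) (sym eq) p≤q
... | inj₂ eq = subst (ℚ._≤ q) (sym eq) -p≤q

0≤q-p⇒p≤q : ∀ p q → 0ℚ ℚ.≤ q ℚ.- p → p ℚ.≤ q
0≤q-p⇒p≤q p q 0≤q-p = subst₂ ℚ._≤_ (ℚ.+-identityʳ p)
  (solve 2 (λ x y → x :+ (y :- x) := y) refl p q) (ℚ.+-monoʳ-≤ p 0≤q-p)

archimedean : ∀ {ε} → 0ℚ ℚ.< ε → ∀ g → Σ[ N ∈ ℕ ] (∀ t → N ℕ.≤ t → ι (+ g) ℚ.≤ ι (+ t) ℚ.* ε)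
archimedean {ε@(ℚ.mkℚ (+ zero) _ _)} 0<ε g =
  contradiction (sym (ℚ.↥p≡0⇒p≡0 ε refl)) (ℚ.<⇒≢ 0<ε)
archimedean {ε@(ℚ.mkℚ -[1+ _ ] _ _)} (ℚ.*<* ())
-- The numerator of `ε` is at least 1, so `ε` is at least the reciprocal of its denominator and `g`
-- times that denominator suffices.
archimedean {ε@(ℚ.mkℚ (+ suc p) d _)} 0<ε g = g ℕ.* suc d , λ t g*d≤t → begin
  ι (+ g)                               ≡⟨ ℚ.*-identityʳ (ι (+ g)) ⟨
  ι (+ g) ℚ.* 1ℚ                        ≤⟨ ℚ.*-monoˡ-≤-nonNeg (ι (+ g)) {{ι-nonNeg}}
                                             (ι-mono-≤ 1ℤ (+ suc p) (ℤ.+≤+ (ℕ.s≤s ℕ.z≤n))) ⟩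
  ι (+ g) ℚ.* ι (+ suc p)               ≡⟨ cong (ι (+ g) ℚ.*_) (sym (/-*-ι (+ suc p) d)) ⟩
  ι (+ g) ℚ.* ((+ suc p ℚ./ suc d) ℚ.* ι (+ suc d)) ≡⟨ cong (λ x → ι (+ g) ℚ.* (x ℚ.* ι (+ suc d))) (ℚ.↥p/↧p≡p ε) ⟩
  ι (+ g) ℚ.* (ε ℚ.* ι (+ suc d))       ≡⟨ solve 3 (λ x y z → x :* (y :* z) := x :* z :* y) refl (ι (+ g)) ε (ι (+ suc d)) ⟩
  ι (+ g) ℚ.* ι (+ suc d) ℚ.* ε         ≡⟨ cong (ℚ._* ε) (trans (cong ι (ℤ.pos-* g (suc d))) (ι-* (+ g) (+ suc d))) ⟨
  ι (+ (g ℕ.* suc d)) ℚ.* ε             ≤⟨ ℚ.*-monoʳ-≤-nonNeg ε (ι-mono-≤ (+ (g ℕ.* suc d)) (+ t) (ℤ.+≤+ g*d≤t)) ⟩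
  ι (+ t) ℚ.* ε                         ∎
  where
  open ℚ.≤-Reasoning
  ι-nonNeg : ℚ.NonNegative (ι (+ g))
  ι-nonNeg = ℚ.nonNegative (ι-mono-≤ 0ℤ (+ g) (ℤ.+≤+ ℕ.z≤n))

-- Null sequences and sequences bounded away from zero.

Eventually : (ℕ → Set) → Set
Eventually P = Σ[ N ∈ ℕ ] (∀ n → N ℕ.≤ n → P n)

ev-zip : {P Q R : ℕ → Set} → (∀ n → P n → Q n → R n) → Eventually P → Eventually Q → Eventually R
ev-zip f (M , p) (N , q) = M ⊔ N , λ n M⊔N≤n →
  f n (p n (ℕ.m⊔n≤o⇒m≤o M N M⊔N≤n)) (q n (ℕ.m⊔n≤o⇒n≤o M N M⊔N≤n))

ev-map : {P Q : ℕ → Set} → (∀ n → P n → Q n) → Eventually P → Eventually Q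
ev-map f (N , p) = N , λ n N≤n → f n (p n N≤n)

Null : (ℕ → ℚ) → Set
Null s = ∀ ε → 0ℚ ℚ.< ε → Eventually (λ n → ∣ s n ∣ ℚ.< ε)

null-cong : ∀ {s t} → (∀ n → s n ≡ t n) → Null s → Null t
null-cong eq hs ε 0<ε = ev-map (λ n → subst (λ x → ∣ x ∣ ℚ.< ε) (eq n)) (hs ε 0<ε)

null-+ : ∀ {s t} → Null s → Null t → Null (λ n → s n ℚ.+ t n)
null-+ {s} {t} hs ht ε 0<ε = ev-zip
  (λ n p q → ℚ.≤-<-trans (ℚ.∣p+q∣≤∣p∣+∣q∣ (s n) (t n))
    (subst (∣ s n ∣ ℚ.+ ∣ t n ∣ ℚ.<_) (halves ε) (ℚ.+-mono-< p q)))
  (hs (½ ℚ.* ε) (½-pos 0<ε)) (ht (½ ℚ.* ε) (½-pos 0<ε))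

null-*ˡ : ∀ (u : ℕ → ℚ) {t : ℕ → ℚ} {B : ℚ} → 0ℚ ℚ.< B → Eventually (λ n → ∣ u n ∣ ℚ.≤ B) →
  Null t → Null (λ n → u n ℚ.* t n)
null-*ˡ u {t} {B} 0<B hu ht ε 0<ε = ev-zip bound hu (ht (ℚ.1/ B ℚ.* ε) (*-pos (ℚ.positive⁻¹ (ℚ.1/ B)) 0<ε))
  where
  open ℚ.≤-Reasoning
  instance
    B-pos : ℚ.Positive B
    B-pos = ℚ.positive 0<B
    B-nonZero : ℚ.NonZero B
    B-nonZero = ℚ.pos⇒nonZero B
    1/B-pos : ℚ.Positive (ℚ.1/ B)
    1/B-pos = ℚ.1/pos⇒pos B
  bound : ∀ n → ∣ u n ∣ ℚ.≤ B → ∣ t n ∣ ℚ.< ℚ.1/ B ℚ.* ε → ∣ u n ℚ.* t n ∣ ℚ.< ε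
  bound n u≤B t<δ = begin-strict
    ∣ u n ℚ.* t n ∣          ≡⟨ ℚ.∣p*q∣≡∣p∣*∣q∣ (u n) (t n) ⟩
    ∣ u n ∣ ℚ.* ∣ t n ∣      ≤⟨ ℚ.*-monoʳ-≤-nonNeg ∣ t n ∣ {{ℚ.∣-∣-nonNeg (t n)}} u≤B ⟩
    B ℚ.* ∣ t n ∣            <⟨ ℚ.*-monoʳ-<-pos B t<δ ⟩
    B ℚ.* (ℚ.1/ B ℚ.* ε)     ≡⟨ ℚ.*-assoc B (ℚ.1/ B) ε ⟨
    B ℚ.* ℚ.1/ B ℚ.* ε       ≡⟨ cong (ℚ._* ε) (ℚ.*-inverseʳ B) ⟩
    1ℚ ℚ.* ε                 ≡⟨ ℚ.*-identityˡ ε ⟩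
    ε                        ∎

null-const-* : ∀ {t : ℕ → ℚ} (c : ℚ) → Null t → Null (λ n → c ℚ.* t n)
null-const-* c = null-*ˡ (λ _ → c) (ℚ.+-mono-≤-< (ℚ.0≤∣p∣ c) (ℚ.positive⁻¹ 1ℚ))
  (0 , λ _ _ → subst (ℚ._≤ ∣ c ∣ ℚ.+ 1ℚ) (ℚ.+-identityʳ ∣ c ∣) (ℚ.+-monoʳ-≤ ∣ c ∣ (ℚ.<⇒≤ (ℚ.positive⁻¹ 1ℚ))))

-- Positivity of a real in constructive form. Unlike termwise positivity, it survives a null
-- perturbation, which is needed because relations in `β` hold only up to null sequences.
BoundedBelow : (ℕ → ℚ) → Set
BoundedBelow s = Σ[ ε ∈ ℚ ] 0ℚ ℚ.< ε × Eventually (λ n → ε ℚ.< s n)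

bb-+ : ∀ {s t} → BoundedBelow s → BoundedBelow t → BoundedBelow (λ n → s n ℚ.+ t n)
bb-+ (ε , 0<ε , hs) (δ , 0<δ , ht) =
  ε ℚ.+ δ , ℚ.+-mono-< 0<ε 0<δ , ev-zip (λ _ → ℚ.+-mono-<) hs ht

bb-* : ∀ {s t} → BoundedBelow s → BoundedBelow t → BoundedBelow (λ n → s n ℚ.* t n)
bb-* (ε , 0<ε , hs) (δ , 0<δ , ht) =
  ε ℚ.* δ , *-pos 0<ε 0<δ , ev-zip (λ _ → *-mono-<-pos 0<ε 0<δ) hs ht

bb-cong : ∀ {s t} → (∀ n → s n ≡ t n) → BoundedBelow s → BoundedBelow t
bb-cong eq (ε , 0<ε , hs) = ε , 0<ε , ev-map (λ n → subst (ε ℚ.<_) (eq n)) hs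

bb-null : ∀ {s t} → BoundedBelow s → Null (λ n → s n ℚ.- t n) → BoundedBelow t
-- Half of the lower bound is spent on the perturbation, the other half remains.
bb-null {s} {t} (ε , 0<ε , hs) hd = δ , ½-pos 0<ε , ev-zip close hs (hd δ (½-pos 0<ε))
  where
  open ℚ.≤-Reasoning
  δ = ½ ℚ.* ε
  close : ∀ n → ε ℚ.< s n → ∣ s n ℚ.- t n ∣ ℚ.< δ → δ ℚ.< t n
  close n ε<s d<δ = begin-strict
    δ                               ≡⟨ solve 1 (λ x → x := x :+ x :- x) refl δ ⟩
    δ ℚ.+ δ ℚ.- δ                   ≡⟨ cong (ℚ._- δ) (halves ε) ⟩
    ε ℚ.- δ                         <⟨ ℚ.+-monoˡ-< (ℚ.- δ) ε<s ⟩
    s n ℚ.- δ                       <⟨ ℚ.+-monoʳ-< (s n) (ℚ.neg-antimono-< (ℚ.≤-<-trans (p≤∣p∣ (s n ℚ.- t n)) d<δ)) ⟩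
    s n ℚ.- (s n ℚ.- t n)           ≡⟨ solve 2 (λ x y → x :- (x :- y) := y) refl (s n) (t n) ⟩
    t n                             ∎

<⇒boundedBelow : ∀ x y → x < y → BoundedBelow (λ n → seq y n ℚ.- seq x n)
<⇒boundedBelow x y (ε , 0<ε , h) = ε , 0<ε , ev-map (λ n p → subst (ℚ._< seq y n ℚ.- seq x n)
  (solve 2 (λ p e → p :+ e :- p := e) refl (seq x n) ε)
  (ℚ.+-monoˡ-< (ℚ.- seq x n) p)) h

boundedBelow⇒< : ∀ x y → BoundedBelow (λ n → seq y n ℚ.- seq x n) → x < y
boundedBelow⇒< x y (ε , 0<ε , h) = ε , 0<ε , ev-map (λ n p → subst (seq x n ℚ.+ ε ℚ.<_)
  (solve 2 (λ p q → p :+ (q :- p) := q) refl (seq x n) (seq y n))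
  (ℚ.+-monoʳ-< (seq x n) p)) h

-- The sequence `G`.

-- Both claims go through one induction, since the next increment is `(m - 2) g + (g - h)`.
-- Nonnegativity is what allows `G m i` to be the number of terms of a sum.
G-mono : ∀ m → + 3 ℤ.≤ m → ∀ i → 0ℤ ℤ.≤ G m i × G m i ℤ.≤ G m (suc i)
G-mono m 3≤m zero = ℤ.≤-refl , ℤ.+≤+ ℕ.z≤n
G-mono m 3≤m (suc i) with G-mono m 3≤m i
... | 0≤h , h≤g = 0≤g , ℤ.0≤i-j⇒j≤i (subst (0ℤ ℤ.≤_) (sym (eq m (G m (suc i)) (G m i)))
        (ℤ.+-mono-≤ 0≤g[m-2] (ℤ.i≤j⇒0≤j-i h≤g)))
  where
  0≤g = ℤ.≤-trans 0≤h h≤g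
  0≤m-2 : 0ℤ ℤ.≤ m ℤ.- + 2
  0≤m-2 = ℤ.i≤j⇒0≤j-i (ℤ.≤-trans (ℤ.+≤+ (ℕ.s≤s (ℕ.s≤s ℕ.z≤n))) 3≤m)
  0≤g[m-2] : 0ℤ ℤ.≤ G m (suc i) ℤ.* (m ℤ.- + 2)
  0≤g[m-2] = subst (ℤ._≤ G m (suc i) ℤ.* (m ℤ.- + 2)) (ℤ.*-zeroʳ (G m (suc i)))
    (ℤ.*-monoˡ-≤-nonNeg (G m (suc i)) {{ℤ.nonNegative 0≤g}} 0≤m-2)
  eq : ∀ m g h → m ℤ.* g ℤ.- h ℤ.- g ≡ g ℤ.* (m ℤ.- + 2) ℤ.+ (g ℤ.- h)
  eq = solve-∀

-- The analogue of Cassini's identity: the recurrence preserves this quadratic form. It is the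
-- determinant of the substitution on pairs given by a power of `β`.
G-det : ∀ m i → G m (suc i) ℤ.* G m (suc i) ℤ.- G m i ℤ.* G m (suc (suc i)) ≡ 1ℤ
G-det m zero = cong (λ x → 1ℤ ℤ.- x) (ℤ.*-zeroˡ (G m 2))
G-det m (suc i) = trans (eq m (G m (suc i)) (G m i)) (G-det m i)
  where
  eq : ∀ m g h → (m ℤ.* g ℤ.- h) ℤ.* (m ℤ.* g ℤ.- h) ℤ.- g ℤ.* (m ℤ.* (m ℤ.* g ℤ.- h) ℤ.- g)
     ≡ g ℤ.* g ℤ.- h ℤ.* (m ℤ.* g ℤ.- h)
  eq = solve-∀

-- Windows and counting.

window-applyUpTo : ∀ n → window n ≡ applyUpTo (λ k → + k ℤ.- + n) (suc (2 ℕ.* n))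
window-applyUpTo n = map-upTo (λ k → + k ℤ.- + n) (suc (2 ℕ.* n))

length-filter-∷ : ∀ {P : Pred ℤ 0ℓ} (P? : Decidable P) x xs →
  + length (filter P? (x ∷ xs)) ≡ indicator (P? x) ℤ.+ + length (filter P? xs)
length-filter-∷ P? x xs with P? x
... | yes _ = refl
... | no  _ = sym (ℤ.+-identityˡ _)

-- From bounded discrepancy to a limit.

unit-interval⇒bounded : ∀ x → 0ℝ < x → x < 1ℝ → Eventually (λ n → ∣ seq x n ∣ ℚ.≤ 1ℚ)
unit-interval⇒bounded x (ε , 0<ε , lo) (δ , 0<δ , hi) = ev-zip
  (λ n 0+ε<x x+δ<1 → ∣p∣≤
    (ℚ.<⇒≤ (ℚ.≤-<-trans (p≤p+q (seq x n) 0<δ) x+δ<1))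
    (ℚ.≤-trans (ℚ.neg-antimono-≤ (ℚ.<⇒≤ (ℚ.≤-<-trans (p≤p+q 0ℚ 0<ε) 0+ε<x))) (ℚ.<⇒≤ (ℚ.positive⁻¹ 1ℚ))))
  lo hi
  where
  p≤p+q : ∀ p {q} → 0ℚ ℚ.< q → p ℚ.≤ p ℚ.+ q
  p≤p+q p {q} 0<q = subst (ℚ._≤ p ℚ.+ q) (ℚ.+-identityʳ p) (ℚ.+-monoʳ-≤ p (ℚ.<⇒≤ 0<q))

∣q-l∣≤δ : ∀ (c : ℤ) t l {B δ} → ∣ ι c ℚ.- ι (+ suc t) ℚ.* l ∣ ℚ.≤ B → B ℚ.≤ ι (+ suc t) ℚ.* δ →
  ∣ c ℚ./ suc t ℚ.- l ∣ ℚ.≤ δ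
∣q-l∣≤δ c t l {B} {δ} disc B≤Tδ = ℚ.*-cancelˡ-≤-pos T {{ℚ.positive 0<T}} (begin
  T ℚ.* ∣ q ℚ.- l ∣        ≡⟨ cong (ℚ._* ∣ q ℚ.- l ∣) (ℚ.0≤p⇒∣p∣≡p (ℚ.<⇒≤ 0<T)) ⟨
  ∣ T ∣ ℚ.* ∣ q ℚ.- l ∣    ≡⟨ ℚ.∣p*q∣≡∣p∣*∣q∣ T (q ℚ.- l) ⟨
  ∣ T ℚ.* (q ℚ.- l) ∣      ≡⟨ cong ∣_∣ (solve 3 (λ t q l → t :* (q :- l) := q :* t :- t :* l) refl T q l) ⟩
  ∣ q ℚ.* T ℚ.- T ℚ.* l ∣  ≡⟨ cong (λ x → ∣ x ℚ.- T ℚ.* l ∣) (/-*-ι c t) ⟩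
  ∣ ι c ℚ.- T ℚ.* l ∣      ≤⟨ disc ⟩
  B                        ≤⟨ B≤Tδ ⟩
  T ℚ.* δ                  ∎)
  where
  open ℚ.≤-Reasoning
  q T : ℚ
  q = c ℚ./ suc t
  T = ι (+ suc t)
  0<T : 0ℚ ℚ.< T
  0<T = ℚ.<-≤-trans (ℚ.positive⁻¹ 1ℚ) (ι-mono-≤ 1ℤ (+ suc t) (ℤ.+≤+ (ℕ.s≤s ℕ.z≤n)))

-- Two limits are interleaved: `n` is the size of the window, `k` the precision of the reals. The
-- threshold for `k` may depend on `n`, but that for `n` depends only on `ε` and `r`. The sequence
-- `l` is kept apart from `seq d` so that a linear expression in `β` can stand in for a power of
-- `β`.
bounded-discrepancy⇒⟶ : ∀ (c : ℕ → ℤ) (d : ℝ) (l : ℕ → ℚ) → Null (λ k → l k ℚ.- seq d k) → ∀ r →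
  (∀ n → Eventually (λ k → ∣ ι (c n) ℚ.- ι (+ suc (2 ℕ.* n)) ℚ.* l k ∣ ℚ.≤ ι (+ r))) →
  (λ n → fromℚ (c n ℚ./ suc (2 ℕ.* n))) ⟶ d
bounded-discrepancy⇒⟶ c d l l→d r disc ε (e , 0<e , e<ε) = N , λ n N≤n →
  ½ ℚ.* e , ½-pos 0<e , ev-zip (λ k → margin (seq ε k) (∣ q n ℚ.- seq d k ∣)) e<ε (close n N≤n)
  where
  open ℚ.≤-Reasoning
  -- A quarter of `e` for each of the two errors; the remaining half is the margin that `_<_` on ℝ
  -- demands.
  δ : ℚ
  δ = ½ ℚ.* (½ ℚ.* e)
  0<δ : 0ℚ ℚ.< δ
  0<δ = ½-pos (½-pos 0<e)
  N : ℕ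
  N = proj₁ (archimedean 0<δ r)
  q : ℕ → ℚ
  q n = c n ℚ./ suc (2 ℕ.* n)
  margin : ∀ x y → 0ℚ ℚ.+ e ℚ.< x → y ℚ.< ½ ℚ.* e → y ℚ.+ ½ ℚ.* e ℚ.< x
  margin x y e<x y<½e = begin-strict
    y ℚ.+ ½ ℚ.* e           <⟨ ℚ.+-monoˡ-< (½ ℚ.* e) y<½e ⟩
    ½ ℚ.* e ℚ.+ ½ ℚ.* e     ≡⟨ halves e ⟩
    e                       ≡⟨ ℚ.+-identityˡ e ⟨
    0ℚ ℚ.+ e                <⟨ e<x ⟩
    x                       ∎
  close : ∀ n → N ℕ.≤ n → Eventually (λ k → ∣ q n ℚ.- seq d k ∣ ℚ.< ½ ℚ.* e)
  close n N≤n = ev-zip (λ k disc-k l≈d → begin-strict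
      ∣ q n ℚ.- seq d k ∣
        ≡⟨ cong ∣_∣ (solve 3 (λ q l y → q :- y := q :- l :+ (l :- y)) refl (q n) (l k) (seq d k)) ⟩
      ∣ q n ℚ.- l k ℚ.+ (l k ℚ.- seq d k) ∣
        ≤⟨ ℚ.∣p+q∣≤∣p∣+∣q∣ (q n ℚ.- l k) (l k ℚ.- seq d k) ⟩
      ∣ q n ℚ.- l k ∣ ℚ.+ ∣ l k ℚ.- seq d k ∣
        <⟨ ℚ.+-mono-≤-< (∣q-l∣≤δ (c n) (2 ℕ.* n) (l k) disc-k
             (proj₂ (archimedean 0<δ r) (suc (2 ℕ.* n)) (ℕ.≤-trans N≤n (ℕ.m≤n⇒m≤1+n (ℕ.m≤m+n n (n ℕ.+ 0)))))) l≈d ⟩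
      δ ℚ.+ δ
        ≡⟨ halves (½ ℚ.* e) ⟩
      ½ ℚ.* e ∎)
    (disc n) (l→d δ 0<δ)

-- The ordered ring ℤ[β].

module Root (m : ℤ) (β : ℝ) (0<β : 0ℝ < β) (β<1 : β < 1ℝ)
            (root : β ^ 2 - fromℤ m * β ≃ fromℤ -1ℤ) where

  b : ℕ → ℚ
  b = seq β

  Lin : ℤ → ℤ → ℕ → ℚ
  Lin u v n = ι u ℚ.+ ι v ℚ.* b n

  root-null : Null (λ n → b n ℚ.* b n ℚ.- ι m ℚ.* b n ℚ.+ 1ℚ)
  root-null = null-cong
    (λ n → solve 2 (λ x y → x :* (x :* con 1ℚ) :+ :- (y :* x) :- con (ℚ.- 1ℚ) := x :* x :- y :* x :+ con 1ℚ)
      refl (b n) (ι m))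
    root

  -- u + v β is positive and apart from 0.
  record Positive (u v : ℤ) : Set where
    constructor positive
    field
      boundedBelow : BoundedBelow (Lin u v)

  positive-≡ : ∀ {u u′ v v′} → u ≡ u′ → v ≡ v′ → Positive u v → Positive u′ v′
  positive-≡ refl refl p = p

  positive-1 : Positive 1ℤ 0ℤ
  positive-1 = positive (½ , ℚ.positive⁻¹ ½ , 0 , λ n _ → subst (½ ℚ.<_)
    (solve 1 (λ x → con 1ℚ := con 1ℚ :+ con 0ℚ :* x) refl (b n))
    (ℚ.*<* (ℤ.+<+ (ℕ.s≤s (ℕ.s≤s ℕ.z≤n)))))

  positive-β : Positive 0ℤ 1ℤ
  positive-β = positive (bb-cong
    (λ n → solve 1 (λ x → x :- con 0ℚ := con 0ℚ :+ con 1ℚ :* x) refl (b n))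
    (<⇒boundedBelow 0ℝ β 0<β))

  positive-1-β : Positive 1ℤ -1ℤ
  positive-1-β = positive (bb-cong
    (λ n → solve 1 (λ x → con 1ℚ :- x := con 1ℚ :+ con (ℚ.- 1ℚ) :* x) refl (b n))
    (<⇒boundedBelow β 1ℝ β<1))

  positive-+ : ∀ {u v u′ v′} → Positive u v → Positive u′ v′ → Positive (u ℤ.+ u′) (v ℤ.+ v′)
  positive-+ {u} {v} {u′} {v′} (positive p) (positive q) = positive (bb-cong lin-+ (bb-+ p q))
    where
    lin-+ : ∀ n → Lin u v n ℚ.+ Lin u′ v′ n ≡ Lin (u ℤ.+ u′) (v ℤ.+ v′) n
    lin-+ n = trans
      (solve 5 (λ u v u′ v′ x → u :+ v :* x :+ (u′ :+ v′ :* x) := u :+ u′ :+ (v :+ v′) :* x) refl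
        (ι u) (ι v) (ι u′) (ι v′) (b n))
      (cong₂ (λ s t → s ℚ.+ t ℚ.* b n) (sym (ι-+ u u′)) (sym (ι-+ v v′)))

  -- The coordinates of (u + v β) (u′ + v′ β), by β² = m β - 1.
  times₁ times₂ : ℤ → ℤ → ℤ → ℤ → ℤ
  times₁ u v u′ v′ = u ℤ.* u′ ℤ.- v ℤ.* v′
  times₂ u v u′ v′ = u ℤ.* v′ ℤ.+ v ℤ.* u′ ℤ.+ m ℤ.* v ℤ.* v′

  -- The termwise product and the product of pairs differ by `v v′` times the polynomial of `β`,
  -- which is null by `root-null`.
  lin-*-null : ∀ u v u′ v′ →
    Null (λ n → Lin u v n ℚ.* Lin u′ v′ n ℚ.- Lin (times₁ u v u′ v′) (times₂ u v u′ v′) n)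
  lin-*-null u v u′ v′ = null-cong eq (null-const-* (ι v ℚ.* ι v′) root-null)
    where
    ι-times₁ : ι (times₁ u v u′ v′) ≡ ι u ℚ.* ι u′ ℚ.- ι v ℚ.* ι v′
    ι-times₁ = trans (ι-+ (u ℤ.* u′) (ℤ.- (v ℤ.* v′)))
      (cong₂ ℚ._+_ (ι-* u u′) (trans (ι-neg (v ℤ.* v′)) (cong ℚ.-_ (ι-* v v′))))
    ι-times₂ : ι (times₂ u v u′ v′) ≡ ι u ℚ.* ι v′ ℚ.+ ι v ℚ.* ι u′ ℚ.+ ι m ℚ.* ι v ℚ.* ι v′
    ι-times₂ = trans (ι-+ (u ℤ.* v′ ℤ.+ v ℤ.* u′) (m ℤ.* v ℤ.* v′)) (cong₂ ℚ._+_
      (trans (ι-+ (u ℤ.* v′) (v ℤ.* u′)) (cong₂ ℚ._+_ (ι-* u v′) (ι-* v u′)))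
      (trans (ι-* (m ℤ.* v) v′) (cong (ℚ._* ι v′) (ι-* m v))))
    eq : ∀ n → ι v ℚ.* ι v′ ℚ.* (b n ℚ.* b n ℚ.- ι m ℚ.* b n ℚ.+ 1ℚ) ≡
               Lin u v n ℚ.* Lin u′ v′ n ℚ.- Lin (times₁ u v u′ v′) (times₂ u v u′ v′) n
    eq n = trans
      (solve 6 (λ u v u′ v′ m x →
          v :* v′ :* (x :* x :- m :* x :+ con 1ℚ) :=
          (u :+ v :* x) :* (u′ :+ v′ :* x) :-
          (u :* u′ :- v :* v′ :+ (u :* v′ :+ v :* u′ :+ m :* v :* v′) :* x)) refl
        (ι u) (ι v) (ι u′) (ι v′) (ι m) (b n))
      (sym (cong₂ (λ s t → Lin u v n ℚ.* Lin u′ v′ n ℚ.- (s ℚ.+ t ℚ.* b n)) ι-times₁ ι-times₂))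

  positive-* : ∀ {u v u′ v′} → Positive u v → Positive u′ v′ →
               Positive (times₁ u v u′ v′) (times₂ u v u′ v′)
  positive-* {u} {v} {u′} {v′} (positive p) (positive q) =
    positive (bb-null (bb-* p q) (lin-*-null u v u′ v′))

  ¬positive-0 : ¬ Positive 0ℤ 0ℤ
  ¬positive-0 (positive (ε , 0<ε , N , h)) = ℚ.<-asym 0<ε
    (subst (ε ℚ.<_) (solve 1 (λ x → con 0ℚ :+ con 0ℚ :* x := con 0ℚ) refl (b N)) (h N ℕ.≤-refl))

  -- Zero is a condition on the coefficients, hence decidable; `sign` shows that nothing is lost by
  -- this.
  NonNeg : ℤ → ℤ → Set
  NonNeg u v = Positive u v ⊎ (u ≡ 0ℤ × v ≡ 0ℤ)

  nonNeg-0 : NonNeg 0ℤ 0ℤ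
  nonNeg-0 = inj₂ (refl , refl)

  nonNeg-≡ : ∀ {u u′ v v′} → u ≡ u′ → v ≡ v′ → NonNeg u v → NonNeg u′ v′
  nonNeg-≡ refl refl p = p

  positive-+-nonNeg : ∀ {u v u′ v′} → Positive u v → NonNeg u′ v′ → Positive (u ℤ.+ u′) (v ℤ.+ v′)
  positive-+-nonNeg p (inj₁ q) = positive-+ p q
  positive-+-nonNeg {u} {v} p (inj₂ (refl , refl)) =
    positive-≡ (sym (ℤ.+-identityʳ u)) (sym (ℤ.+-identityʳ v)) p

  nonNeg-+ : ∀ {u v u′ v′} → NonNeg u v → NonNeg u′ v′ → NonNeg (u ℤ.+ u′) (v ℤ.+ v′)
  nonNeg-+ (inj₁ p) q = inj₁ (positive-+-nonNeg p q)
  nonNeg-+ {u′ = u′} {v′} (inj₂ (refl , refl)) q =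
    nonNeg-≡ (sym (ℤ.+-identityˡ u′)) (sym (ℤ.+-identityˡ v′)) q

  nonNeg-* : ∀ {u v u′ v′} → Positive u v → NonNeg u′ v′ →
             NonNeg (times₁ u v u′ v′) (times₂ u v u′ v′)
  nonNeg-* p (inj₁ q) = inj₁ (positive-* p q)
  nonNeg-* {u} {v} p (inj₂ (refl , refl)) = inj₂ (eq₁ u v , eq₂ m u v)
    where
    eq₁ : ∀ u v → u ℤ.* 0ℤ ℤ.- v ℤ.* 0ℤ ≡ 0ℤ
    eq₁ = solve-∀
    eq₂ : ∀ m u v → u ℤ.* 0ℤ ℤ.+ v ℤ.* 0ℤ ℤ.+ m ℤ.* v ℤ.* 0ℤ ≡ 0ℤ
    eq₂ = solve-∀

  nonNeg-ℕ* : ∀ n {u v} → NonNeg u v → NonNeg (+ n ℤ.* u) (+ n ℤ.* v)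
  nonNeg-ℕ* zero    {u} {v} _ = nonNeg-≡ (sym (ℤ.*-zeroˡ u)) (sym (ℤ.*-zeroˡ v)) nonNeg-0
  nonNeg-ℕ* (suc n) {u} {v} p =
    nonNeg-≡ (sym (ℤ.suc-* (+ n) u)) (sym (ℤ.suc-* (+ n) v)) (nonNeg-+ p (nonNeg-ℕ* n p))

  positive-ℕ* : ∀ n {u v} → Positive u v → Positive (+ suc n ℤ.* u) (+ suc n ℤ.* v)
  positive-ℕ* n {u} {v} p = positive-≡ (sym (ℤ.suc-* (+ n) u)) (sym (ℤ.suc-* (+ n) v))
    (positive-+-nonNeg p (nonNeg-ℕ* n (inj₁ p)))

  nonNeg-ℕ : ∀ p q → NonNeg (+ p) (+ q)
  nonNeg-ℕ p q = nonNeg-≡ (eq₁ (+ p) (+ q)) (eq₂ (+ p) (+ q))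
    (nonNeg-+ (nonNeg-ℕ* p (inj₁ positive-1)) (nonNeg-ℕ* q (inj₁ positive-β)))
    where
    eq₁ : ∀ p q → p ℤ.* 1ℤ ℤ.+ q ℤ.* 0ℤ ≡ p
    eq₁ = solve-∀
    eq₂ : ∀ p q → p ℤ.* 0ℤ ℤ.+ q ℤ.* 1ℤ ≡ q
    eq₂ = solve-∀

  nonNeg-ℤ : ∀ {z} → 0ℤ ℤ.≤ z → NonNeg z 0ℤ
  nonNeg-ℤ {+ n} _ = nonNeg-ℕ n 0

  positive⇒¬nonNeg-neg : ∀ {u v} → Positive u v → ¬ NonNeg (ℤ.- u) (ℤ.- v)
  positive⇒¬nonNeg-neg {u} {v} p q = ¬positive-0
    (positive-≡ (ℤ.+-inverseʳ u) (ℤ.+-inverseʳ v) (positive-+-nonNeg p q))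

  positive-ℤ : ∀ {z} → Positive z 0ℤ → 0ℤ ℤ.< z
  positive-ℤ {z} p = ℤ.≰⇒> λ z≤0 → positive⇒¬nonNeg-neg p (nonNeg-ℤ (ℤ.neg-mono-≤ z≤0))

  -- Euclidean descent: p - q β = β ((m p - q) - p β), which lowers q when p < q.
  compare-ℕ : ∀ p q → Acc ℕ._<_ (suc q) → Positive (+ p) (ℤ.- + suc q) ⊎ Positive (ℤ.- + p) (+ suc q)
  compare-ℕ zero q _ = inj₂ (positive-≡ (ℤ.*-zeroʳ (+ suc q)) (ℤ.*-identityʳ (+ suc q)) (positive-ℕ* q positive-β))
  compare-ℕ (suc p) q (acc rec) with suc q ℕ.≤? suc p
  -- Here `p - q β = q (1 - β) + (p - q)`, a positive term plus a nonnegative one.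
  ... | yes q≤p = inj₁ (positive-≡ eq₁ (eq₂ (+ suc q))
        (positive-+-nonNeg (positive-ℕ* q positive-1-β) (nonNeg-ℕ (suc p ℕ.∸ suc q) 0)))
    where
    eq₁ : + suc q ℤ.* 1ℤ ℤ.+ + (suc p ℕ.∸ suc q) ≡ + suc p
    eq₁ = trans (cong (ℤ._+ + (suc p ℕ.∸ suc q)) (ℤ.*-identityʳ (+ suc q))) (cong +_ (ℕ.m+[n∸m]≡n q≤p))
    eq₂ : ∀ x → x ℤ.* -1ℤ ℤ.+ 0ℤ ≡ ℤ.- x
    eq₂ = solve-∀
  ... | no q≰p = step (m ℤ.* + suc p ℤ.- + suc q) refl
    where
    d≡ : ∀ m p q → 0ℤ ℤ.* (ℤ.- p) ℤ.+ 1ℤ ℤ.* (m ℤ.* p ℤ.- q) ℤ.+ m ℤ.* 1ℤ ℤ.* (ℤ.- p) ≡ ℤ.- q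
    d≡ = solve-∀
    -d≡ : ∀ m p q → 0ℤ ℤ.* p ℤ.+ 1ℤ ℤ.* (ℤ.- (m ℤ.* p ℤ.- q)) ℤ.+ m ℤ.* 1ℤ ℤ.* p ≡ q
    -d≡ = solve-∀
    p≡ : ∀ p d → 0ℤ ℤ.* d ℤ.- 1ℤ ℤ.* (ℤ.- p) ≡ p
    p≡ = solve-∀
    -p≡ : ∀ p d → 0ℤ ℤ.* d ℤ.- 1ℤ ℤ.* p ≡ ℤ.- p
    -p≡ = solve-∀
    lift⁺ : ∀ d → m ℤ.* + suc p ℤ.- + suc q ≡ d → Positive d (ℤ.- + suc p) → Positive (+ suc p) (ℤ.- + suc q)
    lift⁺ d refl h = positive-≡ (p≡ (+ suc p) d) (d≡ m (+ suc p) (+ suc q)) (positive-* positive-β h)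
    lift⁻ : ∀ d → m ℤ.* + suc p ℤ.- + suc q ≡ d → Positive (ℤ.- d) (+ suc p) → Positive (ℤ.- + suc p) (+ suc q)
    lift⁻ d refl h = positive-≡ (-p≡ (+ suc p) (ℤ.- d)) (-d≡ m (+ suc p) (+ suc q)) (positive-* positive-β h)
    step : ∀ d → m ℤ.* + suc p ℤ.- + suc q ≡ d → Positive (+ suc p) (ℤ.- + suc q) ⊎ Positive (ℤ.- + suc p) (+ suc q)
    step (+ r) eq with compare-ℕ r p (rec (ℕ.≰⇒> q≰p))
    ... | inj₁ h = inj₁ (lift⁺ (+ r) eq h)
    ... | inj₂ h = inj₂ (lift⁻ (+ r) eq h)
    -- With `d = m p - q` negative, `d - p β` is visibly negative and the descent stops.
    step -[1+ r ] eq = inj₂ (lift⁻ -[1+ r ] eq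
      (positive-≡ (eq₁ (+ suc r)) (eq₂ (+ suc r) (+ suc p))
        (positive-+-nonNeg (positive-ℕ* r positive-1) (nonNeg-ℕ 0 (suc p)))))
      where
      eq₁ : ∀ r → r ℤ.* 1ℤ ℤ.+ 0ℤ ≡ r
      eq₁ = solve-∀
      eq₂ : ∀ r p → r ℤ.* 0ℤ ℤ.+ p ≡ p
      eq₂ = solve-∀

  -- Only coefficients of opposite signs need the descent. As `compare-ℕ` has no outcome zero,
  -- `u + v β` vanishes only for `u = v = 0`.
  sign : ∀ u v → Positive u v ⊎ NonNeg (ℤ.- u) (ℤ.- v)
  sign (+ zero) (+ zero) = inj₂ nonNeg-0
  sign (+ suc p) (+ q) = inj₁ (positive-≡ (eq₁ (+ suc p)) (eq₂ (+ suc p) (+ q))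
    (positive-+-nonNeg (positive-ℕ* p positive-1) (nonNeg-ℕ 0 q)))
    where
    eq₁ : ∀ p → p ℤ.* 1ℤ ℤ.+ 0ℤ ≡ p
    eq₁ = solve-∀
    eq₂ : ∀ p q → p ℤ.* 0ℤ ℤ.+ q ≡ q
    eq₂ = solve-∀
  sign (+ zero) (+ suc q) = inj₁ (positive-≡ (ℤ.*-zeroʳ (+ suc q)) (ℤ.*-identityʳ (+ suc q)) (positive-ℕ* q positive-β))
  sign (+ p) -[1+ q ] with compare-ℕ p q (<-wellFounded (suc q))
  ... | inj₁ h = inj₁ h
  ... | inj₂ h = inj₂ (inj₁ h)
  sign -[1+ p ] (+ zero) = inj₂ (nonNeg-ℕ (suc p) 0)
  sign -[1+ p ] (+ suc q) with compare-ℕ (suc p) q (<-wellFounded (suc q))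
  ... | inj₁ h = inj₂ (inj₁ h)
  ... | inj₂ h = inj₁ h
  sign -[1+ p ] -[1+ q ] = inj₂ (nonNeg-ℕ (suc p) (suc q))

  times₁-neg : ∀ u v u′ v′ → u ℤ.* ℤ.- u′ ℤ.- v ℤ.* ℤ.- v′ ≡ ℤ.- (u ℤ.* u′ ℤ.- v ℤ.* v′)
  times₁-neg = solve-∀

  times₂-neg : ∀ m u v u′ v′ → u ℤ.* ℤ.- v′ ℤ.+ v ℤ.* ℤ.- u′ ℤ.+ m ℤ.* v ℤ.* ℤ.- v′
    ≡ ℤ.- (u ℤ.* v′ ℤ.+ v ℤ.* u′ ℤ.+ m ℤ.* v ℤ.* v′)
  times₂-neg = solve-∀

  -- Division without an inverse: the other outcome of `sign` would make the product nonpositive.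
  positive-*-cancel : ∀ {u v u′ v′} → Positive u v →
    Positive (times₁ u v u′ v′) (times₂ u v u′ v′) → Positive u′ v′
  positive-*-cancel {u} {v} {u′} {v′} p q with sign u′ v′
  ... | inj₁ h = h
  ... | inj₂ h = contradiction
    (nonNeg-≡ (times₁-neg u v u′ v′) (times₂-neg m u v u′ v′) (nonNeg-* p h))
    (positive⇒¬nonNeg-neg q)

  nonNeg-*-cancel : ∀ {u v u′ v′} → Positive u v →
    NonNeg (times₁ u v u′ v′) (times₂ u v u′ v′) → NonNeg u′ v′
  nonNeg-*-cancel {u} {v} {u′} {v′} p q with sign (ℤ.- u′) (ℤ.- v′)
  ... | inj₂ h = nonNeg-≡ (ℤ.neg-involutive u′) (ℤ.neg-involutive v′) h
  ... | inj₁ h = contradiction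
    (nonNeg-≡ (sym (trans (cong ℤ.-_ (times₁-neg u v u′ v′)) (ℤ.neg-involutive _)))
              (sym (trans (cong ℤ.-_ (times₂-neg m u v u′ v′)) (ℤ.neg-involutive _))) q)
    (positive⇒¬nonNeg-neg (positive-* p h))

  -- Floors of the multiples of `β`.

  -- The condition `f ≤ j β < 1 + f` on pairs. In contrast to `IsFloor`, whose lower bound is a
  -- negated inequality, it carries positive evidence that can be added and multiplied.
  record Floor (j f : ℤ) : Set where
    constructor _,_
    field
      lower : NonNeg (ℤ.- f) j
      upper : Positive (1ℤ ℤ.+ f) (ℤ.- j)

  floor-0 : Floor 0ℤ 0ℤ
  floor-0 = nonNeg-0 , positive-1

  -- Since `0 < β < 1`, the floor either stays or grows by one, and `sign` tells which.
  floor-suc : ∀ {j f} → Floor j f → Σ[ f′ ∈ ℤ ] Floor (1ℤ ℤ.+ j) f′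
  floor-suc {j} {f} (lo , hi) with sign (1ℤ ℤ.+ f) (ℤ.- (1ℤ ℤ.+ j))
  ... | inj₁ p = f , nonNeg-≡ (ℤ.+-identityˡ (ℤ.- f)) refl (nonNeg-+ (inj₁ positive-β) lo) , p
  ... | inj₂ p = 1ℤ ℤ.+ f , nonNeg-≡ refl (ℤ.neg-involutive (1ℤ ℤ.+ j)) p
               , positive-≡ refl (sym (ℤ.neg-distrib-+ 1ℤ j)) (positive-+ positive-1-β hi)

  floor-pred : ∀ {j f} → Floor j f → Σ[ f′ ∈ ℤ ] Floor (-1ℤ ℤ.+ j) f′
  floor-pred {j} {f} (lo , hi) with sign f (ℤ.- (-1ℤ ℤ.+ j))
  ... | inj₁ p = -1ℤ ℤ.+ f
               , nonNeg-≡ (sym (ℤ.neg-distrib-+ -1ℤ f)) refl (nonNeg-+ (inj₁ positive-1-β) lo)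
               , positive-≡ (eq f) refl p
    where
    eq : ∀ f → f ≡ 1ℤ ℤ.+ (-1ℤ ℤ.+ f)
    eq = solve-∀
  ... | inj₂ p = f , nonNeg-≡ refl (ℤ.neg-involutive (-1ℤ ℤ.+ j)) p
               , positive-≡ (ℤ.+-identityˡ (1ℤ ℤ.+ f)) (sym (ℤ.neg-distrib-+ -1ℤ j)) (positive-+ positive-β hi)

  floor : ∀ j → Σ[ f ∈ ℤ ] Floor j f
  floor (+ zero) = 0ℤ , floor-0
  floor (+ suc n) = floor-suc (proj₂ (floor (+ n)))
  floor -[1+ zero ] = floor-pred floor-0
  floor -[1+ suc n ] = floor-pred (proj₂ (floor -[1+ n ]))

  floor-≤ : ∀ {j f f′} → Floor j f → Floor j f′ → f ℤ.≤ f′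
  floor-≤ {j} {f} {f′} (lo , _) (_ , hi) = ℤ.≮⇒≥ λ f′<f →
    positive⇒¬nonNeg-neg
      (positive-≡ refl (ℤ.+-inverseˡ j) (positive-+-nonNeg hi lo))
      (nonNeg-≡ (eq f f′) refl (nonNeg-ℤ (ℤ.i≤j⇒0≤j-i (ℤ.i<j⇒suc[i]≤j f′<f))))
    where
    eq : ∀ f f′ → f ℤ.- (1ℤ ℤ.+ f′) ≡ ℤ.- (1ℤ ℤ.+ f′ ℤ.- f)
    eq = solve-∀

  floor-unique : ∀ {j f f′} → Floor j f → Floor j f′ → f ≡ f′
  floor-unique h h′ = ℤ.≤-antisym (floor-≤ h h′) (floor-≤ h′ h)

  -- The real `x` is abstract because `V` multiplies by `β` on the right and the theorem on the
  -- left.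
  floor⇒isFloor : ∀ (x : ℝ) j f → (∀ n → seq x n ≡ ι j ℚ.* b n) → Floor j f → IsFloor x f
  floor⇒isFloor x j f x≡jb (lo , hi) = record { below = below ; greatest = greatest }
    where
    lin : ∀ l n → ι l ℚ.- seq x n ≡ Lin l (ℤ.- j) n
    lin l n = trans (cong (λ y → ι l ℚ.- y) (x≡jb n))
      (trans (solve 3 (λ l j y → l :- j :* y := l :+ (:- j) :* y) refl (ι l) (ι j) (b n))
        (cong (λ z → ι l ℚ.+ z ℚ.* b n) (sym (ι-neg j))))
    below : fromℤ f ≤ x
    below x<f = positive⇒¬nonNeg-neg
      (positive (bb-cong (lin f) (<⇒boundedBelow x (fromℤ f) x<f)))
      (nonNeg-≡ refl (sym (ℤ.neg-involutive j)) lo)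
    greatest : ∀ l → fromℤ l ≤ x → l ℤ.≤ f
    greatest l l≤x = ℤ.≮⇒≥ λ f<l → l≤x (boundedBelow⇒< x (fromℤ l)
      (bb-cong (λ n → sym (lin l n)) (Positive.boundedBelow (positive-≡ (eq f l) (ℤ.+-identityʳ (ℤ.- j))
        (positive-+-nonNeg hi (nonNeg-ℤ (ℤ.i≤j⇒0≤j-i (ℤ.i<j⇒suc[i]≤j f<l))))))))
      where
      eq : ∀ f l → 1ℤ ℤ.+ f ℤ.+ (l ℤ.- (1ℤ ℤ.+ f)) ≡ l
      eq = solve-∀

  isFloor-unique : ∀ {x f f′} → IsFloor x f → IsFloor x f′ → f ≡ f′
  isFloor-unique h h′ = ℤ.≤-antisym
    (IsFloor.greatest h′ _ (IsFloor.below h)) (IsFloor.greatest h _ (IsFloor.below h′))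

  -- Powers of `β`.

  -- β^(i+1) = G (i+1) β - G i.
  positive-power : ∀ i → Positive (ℤ.- G m i) (G m (suc i))
  positive-power zero = positive-β
  positive-power (suc i) = positive-≡ (eq₁ (G m i) (G m (suc i))) (eq₂ m (G m i) (G m (suc i)))
    (positive-* positive-β (positive-power i))
    where
    eq₁ : ∀ h g → 0ℤ ℤ.* ℤ.- h ℤ.- 1ℤ ℤ.* g ≡ ℤ.- g
    eq₁ = solve-∀
    eq₂ : ∀ m h g → 0ℤ ℤ.* g ℤ.+ 1ℤ ℤ.* ℤ.- h ℤ.+ m ℤ.* 1ℤ ℤ.* g ≡ m ℤ.* g ℤ.- h
    eq₂ = solve-∀

  -- By `1 - β^(i+2) = (1 - β^(i+1)) + β^(i+1) (1 - β)`.
  positive-1-power : ∀ i → Positive (1ℤ ℤ.+ G m i) (ℤ.- G m (suc i))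
  positive-1-power zero = positive-1-β
  positive-1-power (suc i) = positive-≡ (eq₁ (G m i) (G m (suc i))) (eq₂ m (G m i) (G m (suc i)))
    (positive-+ (positive-1-power i) (positive-* (positive-power i) positive-1-β))
    where
    eq₁ : ∀ h g → 1ℤ ℤ.+ h ℤ.+ (ℤ.- h ℤ.* 1ℤ ℤ.- g ℤ.* -1ℤ) ≡ 1ℤ ℤ.+ g
    eq₁ = solve-∀
    eq₂ : ∀ m h g → ℤ.- g ℤ.+ (ℤ.- h ℤ.* -1ℤ ℤ.+ g ℤ.* 1ℤ ℤ.+ m ℤ.* g ℤ.* -1ℤ) ≡ ℤ.- (m ℤ.* g ℤ.- h)
    eq₂ = solve-∀

  -- The next error is `β` times the previous one minus `g` times the polynomial of `β`; boundedness
  -- of the terms of `β` keeps the first part null.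
  power-null : ∀ i → Null (λ n → Lin (ℤ.- G m i) (G m (suc i)) n ℚ.- seq (β ^ suc i) n)
  power-null zero = null-cong
    (λ n → solve 1 (λ x → con 0ℚ := con 0ℚ :+ con 1ℚ :* x :- x :* con 1ℚ) refl (b n))
    (λ ε 0<ε → 0 , λ _ _ → 0<ε)
  power-null (suc i) = null-cong eq (null-+
    (null-*ˡ b (ℚ.positive⁻¹ 1ℚ) (unit-interval⇒bounded β 0<β β<1) (power-null i))
    (null-const-* (ℚ.- ι g) root-null))
    where
    h = G m i
    g = G m (suc i)
    eq : ∀ n → b n ℚ.* (Lin (ℤ.- h) g n ℚ.- seq (β ^ suc i) n) ℚ.+ ℚ.- ι g ℚ.* (b n ℚ.* b n ℚ.- ι m ℚ.* b n ℚ.+ 1ℚ) ≡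
               Lin (ℤ.- g) (m ℤ.* g ℤ.- h) n ℚ.- b n ℚ.* seq (β ^ suc i) n
    eq n = trans
      (cong (λ z → b n ℚ.* (z ℚ.+ ι g ℚ.* b n ℚ.- seq (β ^ suc i) n) ℚ.+
                   ℚ.- ι g ℚ.* (b n ℚ.* b n ℚ.- ι m ℚ.* b n ℚ.+ 1ℚ)) (ι-neg h))
      (trans (solve 5 (λ m h g x y →
          x :* (:- h :+ g :* x :- y) :+ (:- g) :* (x :* x :- m :* x :+ con 1ℚ) :=
          :- g :+ (m :* g :- h) :* x :- x :* y) refl (ι m) (ι h) (ι g) (b n) (seq (β ^ suc i) n))
        (cong₂ (λ s t → s ℚ.+ t ℚ.* b n ℚ.- b n ℚ.* seq (β ^ suc i) n)
          (sym (ι-neg g))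
          (sym (trans (ι-+ (m ℤ.* g) (ℤ.- h)) (cong₂ ℚ._+_ (ι-* m g) (ι-neg h))))))

  -- Sums of consecutive floors.

  F : ℤ → ℤ
  F j = proj₁ (floor j)

  floorF : ∀ j → Floor j (F j)
  floorF j = proj₂ (floor j)

  nonNeg-eventually : ∀ {u v} → NonNeg u v → Eventually (λ n → 0ℚ ℚ.≤ Lin u v n)
  nonNeg-eventually (inj₁ (positive (ε , 0<ε , h))) = ev-map (λ n ε<x → ℚ.<⇒≤ (ℚ.<-trans 0<ε ε<x)) h
  nonNeg-eventually (inj₂ (refl , refl)) = 0 , λ n _ →
    ℚ.≤-reflexive (solve 1 (λ x → con 0ℚ := con 0ℚ :+ con 0ℚ :* x) refl (b n))

  ΣF : ℕ → ℤ → ℤ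
  ΣF zero    j = 0ℤ
  ΣF (suc r) j = ΣF r j ℤ.+ F (j ℤ.+ + r)

  -- Both sides are the sum of `F` from `j` to `j + r`, with the first or the last term split off.
  ΣF-shift : ∀ r j → ΣF r (1ℤ ℤ.+ j) ℤ.+ F j ≡ ΣF r j ℤ.+ F (j ℤ.+ + r)
  ΣF-shift zero j = cong (λ x → 0ℤ ℤ.+ F x) (sym (ℤ.+-identityʳ j))
  ΣF-shift (suc r) j = trans (swap (ΣF r (1ℤ ℤ.+ j)) (F (1ℤ ℤ.+ j ℤ.+ + r)) (F j))
    (cong₂ ℤ._+_ (ΣF-shift r j) (cong F (assoc j (+ r))))
    where
    swap : ∀ x y z → x ℤ.+ y ℤ.+ z ≡ x ℤ.+ z ℤ.+ y
    swap = solve-∀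
    assoc : ∀ j r → 1ℤ ℤ.+ j ℤ.+ r ≡ j ℤ.+ (1ℤ ℤ.+ r)
    assoc = solve-∀

  -- Each of the `r` terms grows by more than `t β - 1`. The weak inequality covers the empty sum.
  ΣF-upper : ∀ r x t → NonNeg (+ r ℤ.+ (ΣF r (x ℤ.+ t) ℤ.- ΣF r x)) (ℤ.- (+ r ℤ.* t))
  ΣF-upper zero x t = nonNeg-0
  ΣF-upper (suc r) x t = nonNeg-≡
    (eq₁ (+ r) (ΣF r (x ℤ.+ t)) (ΣF r x) (F (x ℤ.+ t ℤ.+ + r)) (F (x ℤ.+ + r)))
    (eq₂ (+ r) x t)
    (nonNeg-+ (ΣF-upper r x t) (inj₁ (positive-+-nonNeg
      (Floor.upper (floorF (x ℤ.+ t ℤ.+ + r))) (Floor.lower (floorF (x ℤ.+ + r))))))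
    where
    eq₁ : ∀ r s s′ f f′ → r ℤ.+ (s ℤ.- s′) ℤ.+ (1ℤ ℤ.+ f ℤ.+ ℤ.- f′) ≡ 1ℤ ℤ.+ r ℤ.+ (s ℤ.+ f ℤ.- (s′ ℤ.+ f′))
    eq₁ = solve-∀
    eq₂ : ∀ r x t → ℤ.- (r ℤ.* t) ℤ.+ (ℤ.- (x ℤ.+ t ℤ.+ r) ℤ.+ (x ℤ.+ r)) ≡ ℤ.- ((1ℤ ℤ.+ r) ℤ.* t)
    eq₂ = solve-∀

  ΣF-lower : ∀ r x t → NonNeg (+ r ℤ.- (ΣF r (x ℤ.+ t) ℤ.- ΣF r x)) (+ r ℤ.* t)
  ΣF-lower zero x t = nonNeg-0
  ΣF-lower (suc r) x t = nonNeg-≡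
    (eq₁ (+ r) (ΣF r (x ℤ.+ t)) (ΣF r x) (F (x ℤ.+ t ℤ.+ + r)) (F (x ℤ.+ + r)))
    (eq₂ (+ r) x t)
    (nonNeg-+ (ΣF-lower r x t) (inj₁ (positive-+-nonNeg
      (Floor.upper (floorF (x ℤ.+ + r))) (Floor.lower (floorF (x ℤ.+ t ℤ.+ + r))))))
    where
    eq₁ : ∀ r s s′ f f′ → r ℤ.- (s ℤ.- s′) ℤ.+ (1ℤ ℤ.+ f′ ℤ.+ ℤ.- f) ≡ 1ℤ ℤ.+ r ℤ.- (s ℤ.+ f ℤ.- (s′ ℤ.+ f′))
    eq₁ = solve-∀
    eq₂ : ∀ r x t → r ℤ.* t ℤ.+ (ℤ.- (x ℤ.+ r) ℤ.+ (x ℤ.+ t ℤ.+ r)) ≡ (1ℤ ℤ.+ r) ℤ.* t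
    eq₂ = solve-∀

  -- The mismatches for a shift by `g`.

  module Shift (i : ℕ) where

    -- The index is one less than in the theorem: `V m β (suc i)` is the set under study and
    -- `g β - h` is β^(i+1).
    h g g′ : ℤ
    h  = G m i
    g  = G m (suc i)
    g′ = G m (suc (suc i))

    -- 0 < p - j β ≤ β^(i+1). For j = k g′ - (f + 1) g and p = k g - (f + 1) h one has
    -- p - j β = β^(i+1) (f + 1 - k β), and by G-det every pair (p , j) has this form.
    Near : ℤ → ℤ → Set
    Near p j = Positive p (ℤ.- j) × NonNeg (ℤ.- (p ℤ.+ h)) (j ℤ.+ g)

    Near⇒V : ∀ p j → Near p j → V m β (suc i) j
    Near⇒V p j (pos , neg) = k , f , floor⇒isFloor (fromℤ k * β) k f (λ _ → refl) (lo , hi) , j≡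
      where
      k f : ℤ
      -- Cramer's rule for the two equations expressing `j` and `p` through `k` and `f + 1`, whose
      -- determinant is 1.
      k = g ℤ.* p ℤ.- h ℤ.* j
      f = g′ ℤ.* p ℤ.- g ℤ.* j ℤ.- 1ℤ
      unit : ∀ x y → y ≡ (g ℤ.* g ℤ.- h ℤ.* g′) ℤ.* x → x ≡ y
      unit x y eq = sym (trans eq (trans (cong (ℤ._* x) (G-det m i)) (ℤ.*-identityˡ x)))
      eq-j : ∀ p j h g g′ → (g ℤ.* p ℤ.- h ℤ.* j) ℤ.* g′ ℤ.- (g′ ℤ.* p ℤ.- g ℤ.* j ℤ.- 1ℤ ℤ.+ 1ℤ) ℤ.* g ≡
        (g ℤ.* g ℤ.- h ℤ.* g′) ℤ.* j
      eq-j = solve-∀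
      j≡ : j ≡ k ℤ.* g′ ℤ.- (f ℤ.+ 1ℤ) ℤ.* g
      j≡ = unit j _ (eq-j p j h g g′)
      eq-p : ∀ p j h g g′ → (g ℤ.* p ℤ.- h ℤ.* j) ℤ.* g ℤ.- (g′ ℤ.* p ℤ.- g ℤ.* j ℤ.- 1ℤ ℤ.+ 1ℤ) ℤ.* h ≡
        (g ℤ.* g ℤ.- h ℤ.* g′) ℤ.* p
      eq-p = solve-∀
      p≡ : p ≡ k ℤ.* g ℤ.- (f ℤ.+ 1ℤ) ℤ.* h
      p≡ = unit p _ (eq-p p j h g g′)
      hi : Positive (1ℤ ℤ.+ f) (ℤ.- k)
      hi = positive-*-cancel (positive-power i)
        (positive-≡ (trans p≡ (eq₁ k f h g)) (trans (cong ℤ.-_ j≡) (eq₂ m k f h g)) pos)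
        where
        eq₁ : ∀ k f h g → k ℤ.* g ℤ.- (f ℤ.+ 1ℤ) ℤ.* h ≡ ℤ.- h ℤ.* (1ℤ ℤ.+ f) ℤ.- g ℤ.* ℤ.- k
        eq₁ = solve-∀
        eq₂ : ∀ m k f h g → ℤ.- (k ℤ.* (m ℤ.* g ℤ.- h) ℤ.- (f ℤ.+ 1ℤ) ℤ.* g) ≡
          ℤ.- h ℤ.* ℤ.- k ℤ.+ g ℤ.* (1ℤ ℤ.+ f) ℤ.+ m ℤ.* g ℤ.* ℤ.- k
        eq₂ = solve-∀
      -- The second half of `Near` reads `β^(i+1) - (p - j β) = β^(i+1) (k β - f)`; cancel the
      -- power.
      lo : NonNeg (ℤ.- f) k
      lo = nonNeg-*-cancel (positive-power i)
        (nonNeg-≡ (trans (cong (λ x → ℤ.- (x ℤ.+ h)) p≡) (eq₁ k f h g)) (trans (cong (ℤ._+ g) j≡) (eq₂ m k f h g)) neg)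
        where
        eq₁ : ∀ k f h g → ℤ.- (k ℤ.* g ℤ.- (f ℤ.+ 1ℤ) ℤ.* h ℤ.+ h) ≡ ℤ.- h ℤ.* ℤ.- f ℤ.- g ℤ.* k
        eq₁ = solve-∀
        eq₂ : ∀ m k f h g → k ℤ.* (m ℤ.* g ℤ.- h) ℤ.- (f ℤ.+ 1ℤ) ℤ.* g ℤ.+ g ≡
          ℤ.- h ℤ.* k ℤ.+ g ℤ.* ℤ.- f ℤ.+ m ℤ.* g ℤ.* k
        eq₂ = solve-∀

    V⇒Near : ∀ j → V m β (suc i) j → Σ[ p ∈ ℤ ] Near p j
    V⇒Near j (k , f , isFloor , refl) = k ℤ.* g ℤ.- (f ℤ.+ 1ℤ) ℤ.* h
      , positive-≡ (eq₁ k f h g) (eq₂ m k f h g) (positive-* (positive-power i) (Floor.upper floor-f))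
      , nonNeg-≡ (eq₃ k f h g) (eq₄ m k f h g) (nonNeg-* (positive-power i) (Floor.lower floor-f))
      where
      -- `IsFloor` yields no positive evidence by itself, so `f` is identified with the computed
      -- floor, which has it.
      floor-f : Floor k f
      floor-f = subst (Floor k)
        (isFloor-unique (floor⇒isFloor (fromℤ k * β) k (F k) (λ _ → refl) (floorF k)) isFloor)
        (floorF k)
      eq₁ : ∀ k f h g → ℤ.- h ℤ.* (1ℤ ℤ.+ f) ℤ.- g ℤ.* ℤ.- k ≡ k ℤ.* g ℤ.- (f ℤ.+ 1ℤ) ℤ.* h
      eq₁ = solve-∀
      eq₂ : ∀ m k f h g → ℤ.- h ℤ.* ℤ.- k ℤ.+ g ℤ.* (1ℤ ℤ.+ f) ℤ.+ m ℤ.* g ℤ.* ℤ.- k ≡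
        ℤ.- (k ℤ.* (m ℤ.* g ℤ.- h) ℤ.- (f ℤ.+ 1ℤ) ℤ.* g)
      eq₂ = solve-∀
      eq₃ : ∀ k f h g → ℤ.- h ℤ.* ℤ.- f ℤ.- g ℤ.* k ≡ ℤ.- (k ℤ.* g ℤ.- (f ℤ.+ 1ℤ) ℤ.* h ℤ.+ h)
      eq₃ = solve-∀
      eq₄ : ∀ m k f h g → ℤ.- h ℤ.* k ℤ.+ g ℤ.* ℤ.- f ℤ.+ m ℤ.* g ℤ.* k ≡
        k ℤ.* (m ℤ.* g ℤ.- h) ℤ.- (f ℤ.+ 1ℤ) ℤ.* g ℤ.+ g
      eq₄ = solve-∀

    -- The hypothesis says that `1 + F j` exceeds `j β` by more than β^(i+1). Every integer `p`
    -- above `j β` is at least `1 + F j`, so none is near.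
    far⇒¬V : ∀ j → Positive (1ℤ ℤ.+ F j ℤ.+ h) (ℤ.- (j ℤ.+ g)) → ¬ V m β (suc i) j
    far⇒¬V j far v = refute (V⇒Near j v)
      where
      eq : ∀ p f h → ℤ.- (p ℤ.+ h) ℤ.+ (p ℤ.- f ℤ.- 1ℤ) ≡ ℤ.- (1ℤ ℤ.+ f ℤ.+ h)
      eq = solve-∀
      refute : ¬ (Σ[ p ∈ ℤ ] Near p j)
      refute (p , pos-p , neg-p) = positive⇒¬nonNeg-neg far
        (nonNeg-≡ (eq p (F j) h) (trans (ℤ.+-identityʳ (j ℤ.+ g)) (sym (ℤ.neg-involutive (j ℤ.+ g))))
          (nonNeg-+ neg-p (nonNeg-ℤ (ℤ.i≤j⇒0≤j-i (ℤ.i<j⇒suc[i]≤j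
            (positive-ℤ (positive-≡ refl (ℤ.+-inverseˡ j)
              (positive-+-nonNeg pos-p (Floor.lower (floorF j))))))))))

    -- One comparison settles both membership and the new floor. Taking its outcome as an argument
    -- lets `indicator d` reduce in each case.
    decide′ : ∀ j →
      Positive (1ℤ ℤ.+ F j ℤ.+ h) (ℤ.- (j ℤ.+ g)) ⊎ NonNeg (ℤ.- (1ℤ ℤ.+ F j ℤ.+ h)) (ℤ.- ℤ.- (j ℤ.+ g)) →
      Σ[ d ∈ Dec (V m β (suc i) j) ] Floor (j ℤ.+ g) (F j ℤ.+ h ℤ.+ indicator d)
    decide′ j (inj₁ far) = no (far⇒¬V j far) ,
      (nonNeg-≡ (eq₁ (F j) h) refl (nonNeg-+ (Floor.lower (floorF j)) (inj₁ (positive-power i)))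
      , positive-≡ (eq₂ (F j) h) refl far)
      where
      eq₁ : ∀ f h → ℤ.- f ℤ.+ ℤ.- h ≡ ℤ.- (f ℤ.+ h ℤ.+ 0ℤ)
      eq₁ = solve-∀
      eq₂ : ∀ f h → 1ℤ ℤ.+ f ℤ.+ h ≡ 1ℤ ℤ.+ (f ℤ.+ h ℤ.+ 0ℤ)
      eq₂ = solve-∀
    -- The witness `1 + F j` is the least integer above `j β`. The upper bound for the new floor
    -- adds `1 - β^(i+1) > 0` to the old one.
    decide′ j (inj₂ neg) =
      yes (Near⇒V (1ℤ ℤ.+ F j) j (hi , nonNeg-≡ refl (ℤ.neg-involutive (j ℤ.+ g)) neg)) ,
      (nonNeg-≡ (eq₁ (F j) h) (ℤ.neg-involutive (j ℤ.+ g)) neg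
      , positive-≡ (eq₂ (F j) h) (sym (ℤ.neg-distrib-+ j g)) (positive-+ hi (positive-1-power i)))
      where
      hi = Floor.upper (floorF j)
      eq₁ : ∀ f h → ℤ.- (1ℤ ℤ.+ f ℤ.+ h) ≡ ℤ.- (f ℤ.+ h ℤ.+ 1ℤ)
      eq₁ = solve-∀
      eq₂ : ∀ f h → 1ℤ ℤ.+ f ℤ.+ (1ℤ ℤ.+ h) ≡ 1ℤ ℤ.+ (f ℤ.+ h ℤ.+ 1ℤ)
      eq₂ = solve-∀

    decide : ∀ j → Σ[ d ∈ Dec (V m β (suc i) j) ] Floor (j ℤ.+ g) (F j ℤ.+ h ℤ.+ indicator d)
    decide j = decide′ j (sign (1ℤ ℤ.+ F j ℤ.+ h) (ℤ.- (j ℤ.+ g)))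

    V? : Decidable (V m β (suc i))
    V? j = proj₁ (decide j)

    F-shift : ∀ j → F (j ℤ.+ g) ≡ F j ℤ.+ h ℤ.+ indicator (V? j)
    F-shift j = floor-unique (floorF (j ℤ.+ g)) (proj₂ (decide j))

    -- The density of the mismatches.

    module _ (r : ℕ) (g≡r : g ≡ + r) where

      indicator≡ : ∀ j → indicator (V? j) ≡ ΣF r (1ℤ ℤ.+ j) ℤ.- ΣF r j ℤ.- h
      indicator≡ j = solved (ΣF r (1ℤ ℤ.+ j)) (F j) (ΣF r j) h (indicator (V? j))
        (trans (ΣF-shift r j) (cong (λ x → ΣF r j ℤ.+ x) (trans (cong (λ x → F (j ℤ.+ x)) (sym g≡r)) (F-shift j))))
        where
        eq : ∀ f s h d → d ≡ s ℤ.+ (f ℤ.+ h ℤ.+ d) ℤ.- (f ℤ.+ s ℤ.+ h)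
        eq = solve-∀
        eq′ : ∀ s′ f s h → s′ ℤ.+ f ℤ.- (f ℤ.+ s ℤ.+ h) ≡ s′ ℤ.- s ℤ.- h
        eq′ = solve-∀
        solved : ∀ s′ f s h d → s′ ℤ.+ f ≡ s ℤ.+ (f ℤ.+ h ℤ.+ d) → d ≡ s′ ℤ.- s ℤ.- h
        solved s′ f s h d e = trans (eq f s h d)
          (trans (cong (ℤ._- (f ℤ.+ s ℤ.+ h)) (sym e)) (eq′ s′ f s h))

      -- The enumeration `e` is arbitrary because the tail of `applyUpTo e` enumerates by `e ∘ suc`.
      count-telescopes : ∀ (e : ℕ → ℤ) → (∀ k → e (suc k) ≡ 1ℤ ℤ.+ e k) → ∀ t →
        + length (filter V? (applyUpTo e t)) ≡ ΣF r (e 0 ℤ.+ + t) ℤ.- ΣF r (e 0) ℤ.- + t ℤ.* h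
      count-telescopes e e-suc zero =
        trans (eq (ΣF r (e 0)) h) (cong (λ x → ΣF r x ℤ.- ΣF r (e 0) ℤ.- 0ℤ ℤ.* h) (sym (ℤ.+-identityʳ (e 0))))
        where
        eq : ∀ s h → 0ℤ ≡ s ℤ.- s ℤ.- 0ℤ ℤ.* h
        eq = solve-∀
      count-telescopes e e-suc (suc t) = trans (length-filter-∷ V? (e 0) (applyUpTo (e ∘ suc) t))
        (trans (cong₂ ℤ._+_ (indicator≡ (e 0)) (count-telescopes (e ∘ suc) (e-suc ∘ suc) t))
        (trans (cong (λ x → ΣF r (1ℤ ℤ.+ e 0) ℤ.- ΣF r (e 0) ℤ.- h ℤ.+
                             (ΣF r (x ℤ.+ + t) ℤ.- ΣF r x ℤ.- + t ℤ.* h)) (e-suc 0))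
        (trans (cong (λ x → ΣF r (1ℤ ℤ.+ e 0) ℤ.- ΣF r (e 0) ℤ.- h ℤ.+
                             (ΣF r x ℤ.- ΣF r (1ℤ ℤ.+ e 0) ℤ.- + t ℤ.* h)) (assoc (e 0) (+ t)))
          (eq (ΣF r (1ℤ ℤ.+ e 0)) (ΣF r (e 0)) (ΣF r (e 0 ℤ.+ + suc t)) h (+ t)))))
        where
        assoc : ∀ j r → 1ℤ ℤ.+ j ℤ.+ r ≡ j ℤ.+ (1ℤ ℤ.+ r)
        assoc = solve-∀
        eq : ∀ s₁ s₀ s h t → s₁ ℤ.- s₀ ℤ.- h ℤ.+ (s ℤ.- s₁ ℤ.- t ℤ.* h) ≡ s ℤ.- s₀ ℤ.- (1ℤ ℤ.+ t) ℤ.* h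
        eq = solve-∀

      -- For a window of `t` integers, the count plus `t h` is an increment of `ΣF r` over the
      -- distance `t`, hence within `r` of `r t β`; and `r = g` makes `r t β - t h` equal to
      -- `t (g β - h)`.
      discrepancy : ∀ n → Eventually (λ k →
        ∣ ι (+ count V? n) ℚ.- ι (+ suc (2 ℕ.* n)) ℚ.* Lin (ℤ.- h) g k ∣ ℚ.≤ ι (+ r))
      discrepancy n = ev-zip (λ k hi lo → ∣p∣≤
          (0≤q-p⇒p≤q (d k) (ι (+ r)) (subst (0ℚ ℚ.≤_) (lo≡ k) lo))
          (0≤q-p⇒p≤q (ℚ.- d k) (ι (+ r)) (subst (0ℚ ℚ.≤_) (hi≡ k) hi)))
        (nonNeg-eventually (nonNeg-≡ (cong (λ x → + r ℤ.+ x) Δ≡) refl (ΣF-upper r x₀ (+ t))))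
        (nonNeg-eventually (nonNeg-≡ (cong (λ x → + r ℤ.- x) Δ≡) refl (ΣF-lower r x₀ (+ t))))
        where
        t = suc (2 ℕ.* n)
        c = + count V? n
        d : ℕ → ℚ
        d k = ι c ℚ.- ι (+ t) ℚ.* Lin (ℤ.- h) g k
        x₀ = 0ℤ ℤ.- + n
        e-suc : ∀ k → + suc k ℤ.- + n ≡ 1ℤ ℤ.+ (+ k ℤ.- + n)
        e-suc k = ℤ.+-assoc 1ℤ (+ k) (ℤ.- + n)
        recover : ∀ s s₀ th → s ℤ.- s₀ ≡ (s ℤ.- s₀ ℤ.- th) ℤ.+ th
        recover = solve-∀
        Δ≡ : ΣF r (x₀ ℤ.+ + t) ℤ.- ΣF r x₀ ≡ c ℤ.+ + t ℤ.* h
        Δ≡ = trans (recover (ΣF r (x₀ ℤ.+ + t)) (ΣF r x₀) (+ t ℤ.* h))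
          (cong (ℤ._+ + t ℤ.* h) (sym (trans
            (cong (λ xs → + length (filter V? xs)) (window-applyUpTo n))
            (count-telescopes (λ k → + k ℤ.- + n) e-suc t))))
        ι-Δ : ι (c ℤ.+ + t ℤ.* h) ≡ ι c ℚ.+ ι (+ t) ℚ.* ι h
        ι-Δ = trans (ι-+ c (+ t ℤ.* h)) (cong (ι c ℚ.+_) (ι-* (+ t) h))
        ι-rt : ι (+ r ℤ.* + t) ≡ ι g ℚ.* ι (+ t)
        ι-rt = trans (ι-* (+ r) (+ t)) (cong (λ x → ι x ℚ.* ι (+ t)) (sym g≡r))
        hi≡ : ∀ k → Lin (+ r ℤ.+ (c ℤ.+ + t ℤ.* h)) (ℤ.- (+ r ℤ.* + t)) k ≡
          ι (+ r) ℚ.- (ℚ.- (ι c ℚ.- ι (+ t) ℚ.* Lin (ℤ.- h) g k))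
        hi≡ k = trans (cong₂ (λ u v → u ℚ.+ v ℚ.* b k)
            (trans (ι-+ (+ r) (c ℤ.+ + t ℤ.* h)) (cong (ι (+ r) ℚ.+_) ι-Δ))
            (trans (ι-neg (+ r ℤ.* + t)) (cong ℚ.-_ ι-rt)))
          (trans (solve 6 (λ r c t h g x → r :+ (c :+ t :* h) :+ (:- (g :* t)) :* x :=
              r :- (:- (c :- t :* (:- h :+ g :* x)))) refl
              (ι (+ r)) (ι c) (ι (+ t)) (ι h) (ι g) (b k))
            (cong (λ u → ι (+ r) ℚ.- (ℚ.- (ι c ℚ.- ι (+ t) ℚ.* (u ℚ.+ ι g ℚ.* b k)))) (sym (ι-neg h))))
        lo≡ : ∀ k → Lin (+ r ℤ.- (c ℤ.+ + t ℤ.* h)) (+ r ℤ.* + t) k ≡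
          ι (+ r) ℚ.- (ι c ℚ.- ι (+ t) ℚ.* Lin (ℤ.- h) g k)
        lo≡ k = trans (cong₂ (λ u v → u ℚ.+ v ℚ.* b k)
            (trans (ι-+ (+ r) (ℤ.- (c ℤ.+ + t ℤ.* h)))
              (cong (ι (+ r) ℚ.+_) (trans (ι-neg (c ℤ.+ + t ℤ.* h)) (cong ℚ.-_ ι-Δ))))
            ι-rt)
          (trans (solve 6 (λ r c t h g x → r :- (c :+ t :* h) :+ (g :* t) :* x :=
              r :- (c :- t :* (:- h :+ g :* x))) refl
              (ι (+ r)) (ι c) (ι (+ t)) (ι h) (ι g) (b k))
            (cong (λ u → ι (+ r) ℚ.- (ι c ℚ.- ι (+ t) ℚ.* (u ℚ.+ ι g ℚ.* b k))) (sym (ι-neg h))))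

      density : HasDensity V? (β ^ suc i)
      density = bounded-discrepancy⇒⟶ (λ n → + count V? n) (β ^ suc i) (Lin (ℤ.- h) g) (power-null i) r discrepancy

theorem3 : (m : ℤ) → + 3 ℤ.≤ m →
    (β : ℝ) → 0ℝ < β → β < 1ℝ → β ^ 2 - fromℤ m * β ≃ fromℤ -1ℤ →
    (i : ℕ) → 1 ℕ.≤ i →
    Σ[ V? ∈ Decidable (V m β i) ]
    ((j : ℤ) → ∃₂ λ a b →
    IsFloor (β * fromℤ j) a ×
    IsFloor (β * fromℤ (j ℤ.+ G m i)) b ×
    b ≡ a ℤ.+ G m (i ℕ.∸ 1) ℤ.+ indicator (V? j))
    × HasDensity V? (β ^ i)
-- For an index `suc i` the truncated subtraction in the statement reduces to `i`, so
-- `G m (suc i ∸ 1)` is `h`.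
theorem3 m 3≤m β 0<β β<1 root (suc i) _ = V? ,
  (λ j → F j , F j ℤ.+ h ℤ.+ indicator (V? j) , isFloor j (floorF j) , isFloor (j ℤ.+ g) (proj₂ (decide j)) , refl) ,
  density ℤ.∣ g ∣ (sym (ℤ.0≤i⇒+∣i∣≡i (proj₁ (G-mono m 3≤m (suc i)))))
  where
  open Root m β 0<β β<1 root
  open Shift i
  isFloor : ∀ j {f} → Floor j f → IsFloor (β * fromℤ j) f
  isFloor j {f} = floor⇒isFloor (β * fromℤ j) j f (λ n → ℚ.*-comm (b n) (ι j))
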